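{- Let $r\geq 2$ be an integer, and let $\mathcal{H}$ be a nonempty regular $r$-uniform hypergraph. Then there exists a spanning subhypergraph $\mathcal{C}\subseteq \mathcal{H}$ such that $1\leq \deg_{\mathcal{C}} v\leq 100\log r$ for all $v\in V(\mathcal{H})$. In other words, $f(r)\leq 100\log r$.
   Context: A hypergraph $\mathcal{H}$ consists of a finite vertex set $V(\mathcal{H})$ and a set $E(\mathcal{H})$ of subsets of $V(\mathcal{H})$, called edges. It is nonempty if it has at least one edge. It is $r$-uniform if every edge has exactly $r$ vertices. The degree $\deg_{\mathcal{H}} v$ of a vertex $v$ is the number of edges containing $v$; $\mathcal{H}$ is $d$-regular if every vertex has degree $d$, and regular if it is $d$-regular for some $d$. A spanning subhypergraph $\mathcal{C}\subseteq\mathcal{H}$ is a hypergraph with $V(\mathcal{C})=V(\mathcal{H})$ and $E(\mathcal{C})\subseteq E(\mathcal{H})$. For $r\geq 2$, $f(r)$ denotes the smallest integer $t$ for which every nonempty regular $r$-uniform hypergraph contains a spanning subhypergraph with all degrees between $1$ and $t$. Here $\log$ is the natural logarithm. -}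

module Defs where

open import Data.Nat.Base as ℕ using (ℕ; zero; suc)
import Data.Nat.Properties as ℕ
open import Data.Nat.Tactic.RingSolver using (solve-∀)
open import Data.Integer.Base as ℤ using (ℤ; +_; +[1+_]; +0; -[1+_])
import Data.Integer.Properties as ℤ
open import Data.Rational.Base as ℚ
  using (ℚ; mkℚ; 0ℚ; _/_; _+_; _*_; _-_; -_; _≤_; _<_; ∣_∣; toℚᵘ; *≤*; *<*)
import Data.Rational.Properties as ℚ
import Data.Rational.Unnormalised.Base as ℚᵘ
import Data.Rational.Unnormalised.Properties as ℚᵘ
open import Data.Rational.Solver using (module +-*-Solver)
open import Data.Fin.Base using (Fin)
open import Data.Fin.Subset using (Subset) renaming (∣_∣ to card)
open import Data.Fin.Subset.Properties using (_∈?_)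
open import Data.List.Base using (List; []; length; filter)
open import Data.List.Relation.Unary.All using (All)
open import Data.List.Relation.Unary.Unique.Propositional using (Unique)
import Data.List.Relation.Binary.Subset.Propositional as List
open import Data.Product.Base using (∃-syntax; _×_; _,_)
open import Data.Sum.Base using (inj₁; inj₂)
open import Relation.Binary.PropositionalEquality
  using (_≡_; _≢_; refl; sym; trans; cong; cong₂; subst; subst₂)

-- The edge set is a duplicate-free list, so that lengths count edges.
record Hypergraph (n : ℕ) : Set where
  field
    edges  : List (Subset n)
    unique : Unique edges

open Hypergraph public

module _ {n : ℕ} where

  Nonempty : Hypergraph n → Set
  Nonempty H = edges H ≢ []

  Uniform : ℕ → Hypergraph n → Set
  Uniform r H = All (λ e → card e ≡ r) (edges H)

  deg : Hypergraph n → Fin n → ℕ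
  deg H v = length (filter (v ∈?_) (edges H))

  Regular : Hypergraph n → Set
  Regular H = ∃[ d ] (∀ v → deg H v ≡ d)

  -- Both hypergraphs have vertex set Fin n, so a subhypergraph is spanning.
  _⊆_ : Hypergraph n → Hypergraph n → Set
  C ⊆ H = edges C List.⊆ edges H

  infix 4 _⊆_

Admissible : ℕ → ℕ → Set
Admissible r t =
  ∀ {n} (H : Hypergraph n) → Nonempty H → Regular H → Uniform r H →
  ∃[ C ] (C ⊆ H × (∀ v → 1 ℕ.≤ deg C v × deg C v ℕ.≤ t))

-- "t = f(r)".  A relation, because a least element cannot be extracted
-- constructively from an undecidable property of ℕ.
IsF : ℕ → ℕ → Set
IsF r t = Admissible r t × (∀ t′ → Admissible r t′ → t ℕ.≤ t′)

record ℝ : Set where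
  field
    seq    : ℕ → ℚ
    cauchy : ∀ ε → 0ℚ < ε →
             ∃[ N ] (∀ m n → N ℕ.≤ m → N ℕ.≤ n → ∣ seq m - seq n ∣ ≤ ε)

open ℝ public

_≤ᴿ_ : ℝ → ℝ → Set
x ≤ᴿ y = ∀ ε → 0ℚ < ε → ∃[ N ] (∀ n → N ℕ.≤ n → seq x n ≤ seq y n + ε)

infix 4 _≤ᴿ_

fromℕ : ℕ → ℚ
fromℕ n = + n / 1

recip : ℕ → ℚ
recip j = + 1 / suc j

fromℕᴿ : ℕ → ℝ
fromℕᴿ k .seq _ = fromℕ k
fromℕᴿ k .cauchy ε 0<ε = 0 , λ _ _ _ _ →
  subst (λ q → ∣ q ∣ ≤ ε) (sym (ℚ.+-inverseʳ (fromℕ k))) (ℚ.<⇒≤ 0<ε)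

fromℕ-nonNeg : ∀ k → ℚ.NonNegative (fromℕ k)
fromℕ-nonNeg k = ℚ.normalize-nonNeg k 1

recip-pos : ∀ j → ℚ.Positive (recip j)
recip-pos j = ℚ.normalize-pos 1 (suc j)

fromℕ*recip : ∀ m c j → suc c ≡ m ℕ.* suc j → fromℕ m * recip c ≡ recip j
fromℕ*recip m c j eq = ℚ.toℚᵘ-injective (begin
  toℚᵘ (fromℕ m * recip c)              ≈⟨ ℚ.toℚᵘ-homo-* (fromℕ m) (recip c) ⟩
  toℚᵘ (fromℕ m) ℚᵘ.* toℚᵘ (recip c)    ≈⟨ ℚᵘ.*-cong (ℚ.toℚᵘ-fromℚᵘ (ℚᵘ.mkℚᵘ (+ m) 0)) (ℚ.toℚᵘ-fromℚᵘ (ℚᵘ.mkℚᵘ (+ 1) c)) ⟩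
  ℚᵘ.mkℚᵘ (+ m) 0 ℚᵘ.* ℚᵘ.mkℚᵘ (+ 1) c  ≈⟨ ℚᵘ.*≡* crossed ⟩
  ℚᵘ.mkℚᵘ (+ 1) j                       ≈⟨ ℚᵘ.≃-sym (ℚ.toℚᵘ-fromℚᵘ (ℚᵘ.mkℚᵘ (+ 1) j)) ⟩
  toℚᵘ (recip j)                        ∎)
  where
  open import Relation.Binary.Reasoning.Setoid ℚᵘ.≃-setoid
  crossed : (+ m ℤ.* + 1) ℤ.* + suc j ≡ + 1 ℤ.* + (1 ℕ.* suc c)
  crossed = trans (cong (ℤ._* + suc j) (ℤ.*-identityʳ (+ m)))
            (trans (sym (ℤ.pos-* m (suc j)))
            (trans (cong +_ (trans (sym eq) (sym (ℕ.*-identityˡ (suc c)))))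
                   (sym (ℤ.*-identityˡ _))))

recip-anti : ∀ {i j} → i ℕ.≤ j → recip j ≤ recip i
recip-anti {i} {j} i≤j = ℚ.toℚᵘ-cancel-≤
  (ℚᵘ.≤-respˡ-≃ (ℚᵘ.≃-sym (ℚ.toℚᵘ-fromℚᵘ (ℚᵘ.mkℚᵘ (+ 1) j)))
  (ℚᵘ.≤-respʳ-≃ (ℚᵘ.≃-sym (ℚ.toℚᵘ-fromℚᵘ (ℚᵘ.mkℚᵘ (+ 1) i)))
  (ℚᵘ.*≤* (ℤ.*-monoˡ-≤-nonNeg (+ 1) (ℤ.+≤+ (ℕ.s≤s i≤j))))))

archimedean : ∀ ε → 0ℚ < ε → ∃[ N ] recip N ≤ ε
archimedean (mkℚ +[1+ p ] q c) _ = q , ℚ.toℚᵘ-cancel-≤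
  (ℚᵘ.≤-respˡ-≃ (ℚᵘ.≃-sym (ℚ.toℚᵘ-fromℚᵘ (ℚᵘ.mkℚᵘ (+ 1) q)))
  (ℚᵘ.*≤* (ℤ.*-monoʳ-≤-nonNeg (+ suc q) (ℤ.+≤+ (ℕ.s≤s (ℕ.z≤n {p}))))))
archimedean (mkℚ +0 q c) (*<* (ℤ.+<+ ()))
archimedean (mkℚ -[1+ p ] q c) (*<* ())

_·_ : ℕ → ℝ → ℝ
(k · x) .seq n = fromℕ k * seq x n
(k · x) .cauchy ε 0<ε =
  let instance _ = recip-pos k
      N , close = cauchy x (recip k * ε) (ℚ.positive⁻¹ _ ⦃ ℚ.pos*pos⇒pos (recip k) ε ⦃ ℚ.positive 0<ε ⦄ ⦄)
  in N , λ m n N≤m N≤n → scale (seq x m) (seq x n) (close m n N≤m N≤n)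
  where
  scale : ∀ p q → ∣ p - q ∣ ≤ recip k * ε → ∣ fromℕ k * p - fromℕ k * q ∣ ≤ ε
  scale p q pq = begin
    ∣ fromℕ k * p - fromℕ k * q ∣  ≡⟨ cong ∣_∣ (solve 3 (λ a b c → a :* b :- a :* c := a :* (b :- c)) refl (fromℕ k) p q) ⟩
    ∣ fromℕ k * (p - q) ∣          ≡⟨ ℚ.∣p*q∣≡∣p∣*∣q∣ (fromℕ k) (p - q) ⟩
    ∣ fromℕ k ∣ * ∣ p - q ∣        ≡⟨ cong (_* ∣ p - q ∣) (ℚ.0≤p⇒∣p∣≡p (ℚ.nonNegative⁻¹ (fromℕ k))) ⟩
    fromℕ k * ∣ p - q ∣            ≤⟨ ℚ.*-monoˡ-≤-nonNeg (fromℕ k) pq ⟩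
    fromℕ k * (recip k * ε)        ≤⟨ ℚ.*-monoʳ-≤-nonNeg (recip k * ε) k≤k+1 ⟩
    fromℕ (suc k) * (recip k * ε)  ≡⟨ sym (ℚ.*-assoc (fromℕ (suc k)) (recip k) ε) ⟩
    fromℕ (suc k) * recip k * ε    ≡⟨ cong (_* ε) (fromℕ*recip (suc k) k 0 (sym (ℕ.*-identityʳ (suc k)))) ⟩
    recip 0 * ε                    ≡⟨ ℚ.*-identityˡ ε ⟩
    ε                              ∎
    where
    open ℚ.≤-Reasoning
    open +-*-Solver
    instance
      _ = fromℕ-nonNeg k
      _ = ℚ.pos⇒nonNeg (recip k * ε) ⦃ ℚ.pos*pos⇒pos (recip k) ⦃ recip-pos k ⦄ ε ⦃ ℚ.positive 0<ε ⦄ ⦄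
    k≤k+1 : fromℕ k ≤ fromℕ (suc k)
    k≤k+1 = ℚ.toℚᵘ-cancel-≤
      (ℚᵘ.≤-respˡ-≃ (ℚᵘ.≃-sym (ℚ.toℚᵘ-fromℚᵘ (ℚᵘ.mkℚᵘ (+ k) 0)))
      (ℚᵘ.≤-respʳ-≃ (ℚᵘ.≃-sym (ℚ.toℚᵘ-fromℚᵘ (ℚᵘ.mkℚᵘ (+ suc k) 0)))
      (ℚᵘ.*≤* (ℤ.*-monoʳ-≤-nonNeg (+ 1) (ℤ.+≤+ (ℕ.n≤1+n k))))))

infixr 7 _·_

∑ : ℕ → (ℕ → ℚ) → ℚ
∑ zero    f = 0ℚ
∑ (suc n) f = ∑ n f + f n

-- The left Riemann sum of ∫₁ʳ dt/t with step h = 1/(N+1): the nodes are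
-- t = 1 + k·h for 0 ≤ k < (r−1)(N+1), and h · 1/t = 1/(N+1+k).
riemann : ℕ → ℕ → ℚ
riemann r N = ∑ ((r ℕ.∸ 1) ℕ.* suc N) (λ k → recip (N ℕ.+ k))

∑-cong : ∀ n {f g} → (∀ k → f k ≡ g k) → ∑ n f ≡ ∑ n g
∑-cong zero    eq = refl
∑-cong (suc n) eq = cong₂ _+_ (∑-cong n eq) (eq n)

∑-mono : ∀ n {f g} → (∀ k → k ℕ.< n → f k ≤ g k) → ∑ n f ≤ ∑ n g
∑-mono zero    le = ℚ.≤-refl
∑-mono (suc n) le = ℚ.+-mono-≤ (∑-mono n λ k k<n → le k (ℕ.m<n⇒m<1+n k<n)) (le n ℕ.≤-refl)

∑-split : ∀ m n f → ∑ (n ℕ.+ m) f ≡ ∑ m f + ∑ n (λ j → f (m ℕ.+ j))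
∑-split m zero    f = sym (ℚ.+-identityʳ _)
∑-split m (suc n) f = trans
  (cong₂ _+_ (∑-split m n f) (cong f (ℕ.+-comm n m)))
  (ℚ.+-assoc (∑ m f) (∑ n (λ j → f (m ℕ.+ j))) (f (m ℕ.+ n)))

∑-blocks : ∀ a b f → ∑ (a ℕ.* b) f ≡ ∑ a (λ i → ∑ b (λ j → f (i ℕ.* b ℕ.+ j)))
∑-blocks zero    b f = refl
∑-blocks (suc a) b f = trans (∑-split (a ℕ.* b) b f) (cong (_+ ∑ b (λ j → f (a ℕ.* b ℕ.+ j))) (∑-blocks a b f))

∑-const : ∀ n q → ∑ n (λ _ → q) ≡ fromℕ n * q
∑-const zero    q = sym (ℚ.*-zeroˡ q)
∑-const (suc n) q = trans (cong (_+ q) (∑-const n q))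
  (trans (solve 2 (λ a b → a :* b :+ b := (a :+ con (+ 1 / 1)) :* b) refl (fromℕ n) q)
         (cong (_* q) fromℕ-suc))
  where
  open +-*-Solver
  fromℕ-suc : fromℕ n + fromℕ 1 ≡ fromℕ (suc n)
  fromℕ-suc = ℚ.toℚᵘ-injective
    (ℚᵘ.≃-trans (ℚ.toℚᵘ-homo-+ (fromℕ n) (fromℕ 1))
    (ℚᵘ.≃-trans (ℚᵘ.+-congˡ (toℚᵘ (fromℕ 1)) (ℚ.toℚᵘ-fromℚᵘ (ℚᵘ.mkℚᵘ (+ n) 0)))
    (ℚᵘ.≃-trans (ℚᵘ.*≡* (trans
                    (cong (λ i → (i ℤ.+ + 1) ℤ.* + 1) (ℤ.*-identityʳ (+ n)))
                    (cong (λ i → + i ℤ.* + 1) (ℕ.+-comm n 1))))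
                (ℚᵘ.≃-sym (ℚ.toℚᵘ-fromℚᵘ (ℚᵘ.mkℚᵘ (+ suc n) 0))))))

∑-shift : ∀ n f → ∑ n f + f n ≡ f 0 + ∑ n (λ k → f (suc k))
∑-shift zero    f = ℚ.+-comm 0ℚ (f 0)
∑-shift (suc n) f = trans (cong (_+ f (suc n)) (∑-shift n f)) (ℚ.+-assoc (f 0) (∑ n (λ k → f (suc k))) (f (suc n)))

-- A left sum exceeds its right sum by at most one term; a right sum is at
-- most the left sum on a refinement, which is at most any coarser left sum.
riemannʳ : ℕ → ℕ → ℚ
riemannʳ r N = ∑ ((r ℕ.∸ 1) ℕ.* suc N) (λ k → recip (N ℕ.+ suc k))

left≤right : ∀ r N → riemann r N ≤ recip N + riemannʳ r N
left≤right r N = begin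
  riemann r N                     ≡⟨ sym (ℚ.+-identityʳ (riemann r N)) ⟩
  riemann r N + 0ℚ                ≤⟨ ℚ.+-monoʳ-≤ (riemann r N) (ℚ.<⇒≤ (ℚ.positive⁻¹ _ ⦃ recip-pos (N ℕ.+ n) ⦄)) ⟩
  riemann r N + recip (N ℕ.+ n)   ≡⟨ ∑-shift n (λ k → recip (N ℕ.+ k)) ⟩
  recip (N ℕ.+ 0) + riemannʳ r N  ≡⟨ cong (λ i → recip i + riemannʳ r N) (ℕ.+-identityʳ N) ⟩
  recip N + riemannʳ r N          ∎
  where
  open ℚ.≤-Reasoning
  n = (r ℕ.∸ 1) ℕ.* suc N

subdivide : ∀ m j → recip j ≡ ∑ (suc m) (λ _ → recip (ℕ.pred (suc m ℕ.* suc j)))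
subdivide m j = sym (trans (∑-const (suc m) _) (fromℕ*recip (suc m) _ j refl))

right≤left : ∀ r M N → riemannʳ r N ≤ riemann r M
right≤left r M N = begin
  riemannʳ r N
    ≡⟨ ∑-cong (s ℕ.* suc N) (λ k → subdivide M (N ℕ.+ suc k)) ⟩
  ∑ (s ℕ.* suc N) (λ k → ∑ (suc M) (λ _ → recip (ℕ.pred (suc M ℕ.* suc (N ℕ.+ suc k)))))
    ≤⟨ ∑-mono (s ℕ.* suc N) (λ k _ → ∑-mono (suc M) (λ i i≤M → recip-anti (ℕ.s≤s⁻¹ (lower k i i≤M)))) ⟩
  ∑ (s ℕ.* suc N) (λ k → ∑ (suc M) (λ i → recip (P ℕ.+ (k ℕ.* suc M ℕ.+ i))))
    ≡⟨ sym (∑-blocks (s ℕ.* suc N) (suc M) (λ k → recip (P ℕ.+ k))) ⟩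
  ∑ (s ℕ.* suc N ℕ.* suc M) (λ k → recip (P ℕ.+ k))
    ≡⟨ cong (λ n → ∑ n (λ k → recip (P ℕ.+ k))) (swap s N M) ⟩
  ∑ (s ℕ.* suc M ℕ.* suc N) (λ k → recip (P ℕ.+ k))
    ≡⟨ ∑-blocks (s ℕ.* suc M) (suc N) (λ k → recip (P ℕ.+ k)) ⟩
  ∑ (s ℕ.* suc M) (λ k → ∑ (suc N) (λ i → recip (P ℕ.+ (k ℕ.* suc N ℕ.+ i))))
    ≤⟨ ∑-mono (s ℕ.* suc M) (λ k _ → ∑-mono (suc N) (λ i _ → recip-anti (ℕ.s≤s⁻¹ (upper k i)))) ⟩
  ∑ (s ℕ.* suc M) (λ k → ∑ (suc N) (λ _ → recip (ℕ.pred (suc N ℕ.* suc (M ℕ.+ k)))))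
    ≡⟨ sym (∑-cong (s ℕ.* suc M) (λ k → subdivide N (M ℕ.+ k))) ⟩
  riemann r M ∎
  where
  open ℚ.≤-Reasoning
  s = r ℕ.∸ 1
  P = ℕ.pred (suc N ℕ.* suc M)
  swap : ∀ s N M → s ℕ.* suc N ℕ.* suc M ≡ s ℕ.* suc M ℕ.* suc N
  swap = solve-∀
  lowerEq : ∀ N M k → suc N ℕ.* suc M ℕ.+ (k ℕ.* suc M ℕ.+ suc M) ≡ suc M ℕ.* suc (N ℕ.+ suc k)
  lowerEq = solve-∀
  lower : ∀ k i → i ℕ.< suc M →
          suc N ℕ.* suc M ℕ.+ (k ℕ.* suc M ℕ.+ i) ℕ.≤ suc M ℕ.* suc (N ℕ.+ suc k)
  lower k i i<M = subst (suc N ℕ.* suc M ℕ.+ (k ℕ.* suc M ℕ.+ i) ℕ.≤_) (lowerEq N M k)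
    (ℕ.+-monoʳ-≤ (suc N ℕ.* suc M) (ℕ.+-monoʳ-≤ (k ℕ.* suc M) (ℕ.<⇒≤ i<M)))
  upperEq : ∀ N M k → suc N ℕ.* suc M ℕ.+ k ℕ.* suc N ≡ suc N ℕ.* suc (M ℕ.+ k)
  upperEq = solve-∀
  upper : ∀ k i → suc N ℕ.* suc (M ℕ.+ k) ℕ.≤ suc N ℕ.* suc M ℕ.+ (k ℕ.* suc N ℕ.+ i)
  upper k i = subst (ℕ._≤ suc N ℕ.* suc M ℕ.+ (k ℕ.* suc N ℕ.+ i)) (upperEq N M k)
    (ℕ.+-monoʳ-≤ (suc N ℕ.* suc M) (ℕ.m≤m+n (k ℕ.* suc N) i))

riemann-close : ∀ r M N → riemann r N - riemann r M ≤ recip N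
riemann-close r M N = begin
  riemann r N - riemann r M              ≤⟨ ℚ.+-monoˡ-≤ (- riemann r M) (ℚ.≤-trans (left≤right r N) (ℚ.+-monoʳ-≤ (recip N) (right≤left r M N))) ⟩
  recip N + riemann r M - riemann r M    ≡⟨ solve 2 (λ a b → a :+ b :- b := a) refl (recip N) (riemann r M) ⟩
  recip N                                ∎
  where
  open ℚ.≤-Reasoning
  open +-*-Solver

riemann-cauchy : ∀ r ε → 0ℚ < ε →
  ∃[ N ] (∀ m n → N ℕ.≤ m → N ℕ.≤ n → ∣ riemann r m - riemann r n ∣ ≤ ε)
riemann-cauchy r ε 0<ε with archimedean ε 0<ε
... | N , 1/N≤ε = N , bound
  where
  one-sided : ∀ m n → N ℕ.≤ m → riemann r m - riemann r n ≤ ε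
  one-sided m n N≤m = ℚ.≤-trans (riemann-close r n m) (ℚ.≤-trans (recip-anti N≤m) 1/N≤ε)
  bound : ∀ m n → N ℕ.≤ m → N ℕ.≤ n → ∣ riemann r m - riemann r n ∣ ≤ ε
  bound m n N≤m N≤n with ℚ.∣p∣≡p∨∣p∣≡-p (riemann r m - riemann r n)
  ... | inj₁ eq = subst (_≤ ε) (sym eq) (one-sided m n N≤m)
  ... | inj₂ eq = subst (_≤ ε) (sym (trans eq (neg-diff (riemann r m) (riemann r n)))) (one-sided n m N≤n)
    where
    open +-*-Solver
    neg-diff : ∀ p q → - (p - q) ≡ q - p
    neg-diff = solve 2 (λ a b → :- (a :- b) := b :- a) refl

-- log r = ∫₁ʳ dt/t for r ≥ 1; the value at r = 0 is 0 by truncation.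
log : ℕ → ℝ
log r .seq    = riemann r
log r .cauchy = riemann-cauchy r

{-# OPTIONS --safe #-}
module Submission where

-- Write ℓ = ⌊log₂ r⌋; since log r ≥ ℓ / 2, it suffices to obtain all degrees
-- between 1 and 50 ℓ.  A d-regular H with d ≤ 50 ℓ is its own cover.  If d is at
-- least 13 ℓ r, a Beck-Fiala rounding of the constant weight 13 ℓ r / d on the
-- edges changes no degree by more than r, and leaves a subhypergraph with
-- degrees between 12 ℓ r and 16 ℓ r.  So we may assume that all degrees lie
-- between 12 ℓ q and 16 ℓ q for some q ≤ 2 r.  Now keep every edge independently
-- with probability 1 / q.  A degree is 0 or exceeds 50 ℓ with probability at
-- most 2 ^ (1 - 12 ℓ), by the moments of x ^ X for x = 0 and x = 2, while it
-- shares edges with at most 16 ℓ q r others: the Lovász local lemma applies.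

-- The obstacle is that `d` is not bounded in terms of `r`. A vertex of degree `D` may share edges
-- with about `D * r` others, while a failure probability of `2 ^ (1 - 12 ℓ)` tolerates only
-- polynomially many in `r`, so sampling straight from a huge `d` is beyond the local lemma. The
-- Beck-Fiala error `r` depends neither on `d` nor on the number of vertices, and is at most a
-- thirteenth of the target `13 ℓ r`; one rounding therefore removes `d` from the problem.
--
-- A window for the degrees, rather than an exact degree, serves both routes into the sampling: the
-- rounded hypergraph is no longer regular, and a regular one need not have degree divisible by
-- `12 ℓ`.
--
-- All probabilities stay in `ℕ`: expectations are weighted sums over the outcomes, and each
-- inequality is stated with its denominators cleared.

open import Defs
open import Data.Bool.Base using (Bool; true; false; _∨_; if_then_else_)
open import Data.Fin.Base using (Fin; zero; suc; punchIn)
import Data.Fin.Properties as Fin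
open import Data.Fin.Subset using (Subset; _∈_; _⊂_; _∩_; _-_; ⊤; ∣_∣)
  renaming (_⊆_ to _⊆ˢ_; Nonempty to Inhabited)
open import Data.Fin.Subset.Induction using (⊂-wellFounded; Acc; acc)
open import Data.Fin.Subset.Properties
  using (_∈?_; ∈⊤; p∩q⊆p; p∩q⊆q; x∈p∩q⁺; x∈p⇒p-x⊂p; x∈p∧x≢y⇒x∈p-y; nonempty?; Empty-unique; ∣⊥∣≡0)
open import Data.Integer.Base as ℤ using (ℤ; +_; -[1+_]; 0ℤ; 1ℤ)
import Data.Integer.Properties as ℤ
import Data.Integer.Tactic.RingSolver as ℤ-Solver
open import Data.List.Base as List using (List; []; _∷_; _++_; length; map; filter)
import Data.List.Properties as List
open import Data.List.Membership.Propositional using () renaming (_∈_ to _∈ˡ_)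
open import Data.List.Membership.Propositional.Properties using (∈-map⁺; ∈-∃++; ∈-lookup)
open import Data.List.Relation.Binary.Sublist.Propositional as Sublist using ([]; _∷_; _∷ʳ_)
open import Data.List.Relation.Binary.Sublist.Propositional.Properties using (All-resp-⊆)
open import Data.List.Relation.Unary.All as All using (All; []; _∷_)
import Data.List.Relation.Unary.All.Properties as All
open import Data.List.Relation.Unary.AllPairs using ([]; _∷_)
open import Data.List.Relation.Unary.Any using (here; there)
open import Data.List.Relation.Unary.Unique.Propositional using (Unique)
open import Data.Nat.Base using (ℕ; zero; suc; pred; _+_; _*_; _∸_; _^_; _/_; _≤_; _<_; z≤n; s≤s; s≤s⁻¹; NonZero; ≢-nonZero; >-nonZero)
import Data.Nat.DivMod as ℕ
open import Data.Nat.Induction using (<-rec)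
import Data.Nat.Properties as ℕ
open import Data.Nat.Tactic.RingSolver using (solve-∀)
open import Data.Product.Base using (∃-syntax; _×_; _,_; proj₁; proj₂; map₂)
open import Data.Rational.Base as ℚ using (ℚ; 0ℚ; 1ℚ; ½)
import Data.Rational.Properties as ℚ
open import Data.Rational.Solver using (module +-*-Solver)
open import Data.Sum.Base using (_⊎_; inj₁; inj₂)
open import Data.Vec.Base as Vec using (Vec; []; _∷_; lookup)
open import Data.Vec.Functional using (insertAt)
open import Data.Vec.Functional.Properties using (insertAt-lookup; insertAt-punchIn)
open import Data.Vec.Properties using (lookup∘tabulate; []=⇒lookup; lookup⇒[]=)
open import Function.Base using (_∘_; id)
open import Relation.Binary.PropositionalEquality
  using (_≡_; _≢_; refl; sym; trans; cong; cong₂; subst; subst₂; module ≡-Reasoning)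
open import Relation.Nullary.Decidable using (Dec; yes; no; does; _→-dec_; _×-dec_; ¬?; dec-true)
open import Relation.Nullary.Negation.Core using (¬_; contradiction)
import Algebra.Properties.Semiring.Sum as Sum

open Sum ℕ.+-*-semiring using (sum; sum-cong-≗; sum-remove; sum-replicate-zero; ∑-comm; *-distribˡ-sum; *-distribʳ-sum)
module ℤΣ = Sum ℤ.+-*-semiring

-- Discrepancy rounding

sum-mono : ∀ {n} {f g : Fin n → ℕ} → (∀ i → f i ≤ g i) → sum f ≤ sum g
sum-mono {zero}  f≤g = z≤n
sum-mono {suc n} f≤g = ℕ.+-mono-≤ (f≤g zero) (sum-mono (f≤g ∘ suc))

term≤sum : ∀ {n} (f : Fin n → ℕ) i → f i ≤ sum f
term≤sum f zero    = ℕ.m≤m+n _ _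
term≤sum f (suc i) = ℕ.≤-trans (term≤sum (f ∘ suc) i) (ℕ.m≤n+m _ (f zero))

sum≤n*bound : ∀ {n} (f : Fin n → ℕ) c → (∀ i → f i ≤ c) → sum f ≤ n * c
sum≤n*bound {zero}  f c f≤c = z≤n
sum≤n*bound {suc n} f c f≤c = ℕ.+-mono-≤ (f≤c zero) (sum≤n*bound (f ∘ suc) c (f≤c ∘ suc))

pos-sum : ∀ {n} (f : Fin n → ℕ) → + sum f ≡ ℤΣ.sum (+_ ∘ f)
pos-sum {zero}  f = refl
pos-sum {suc n} f = cong (ℤ._+_ (+ f zero)) (pos-sum (f ∘ suc))

⟦_⟧ : Bool → ℕ
⟦ true ⟧  = 1
⟦ false ⟧ = 0

⟦⟧≤1 : ∀ b → ⟦ b ⟧ ≤ 1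
⟦⟧≤1 true  = ℕ.≤-refl
⟦⟧≤1 false = z≤n

infix 8 _∙_
_∙_ : ∀ {m} → (Fin m → ℤ) → (Fin m → ℤ) → ℤ
x ∙ y = ℤΣ.sum (λ i → x i ℤ.* y i)

∙-linear : ∀ {m} (s t : ℤ) (x y z : Fin m → ℤ) →
  x ∙ (λ i → s ℤ.* y i ℤ.+ t ℤ.* z i) ≡ s ℤ.* (x ∙ y) ℤ.+ t ℤ.* (x ∙ z)
∙-linear s t x y z = begin
  x ∙ (λ i → s ℤ.* y i ℤ.+ t ℤ.* z i)
    ≡⟨ ℤΣ.sum-cong-≗ (λ i → rearrange s t (x i) (y i) (z i)) ⟩
  ℤΣ.sum (λ i → s ℤ.* (x i ℤ.* y i) ℤ.+ t ℤ.* (x i ℤ.* z i))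
    ≡⟨ ℤΣ.∑-distrib-+ (λ i → s ℤ.* (x i ℤ.* y i)) (λ i → t ℤ.* (x i ℤ.* z i)) ⟩
  ℤΣ.sum (λ i → s ℤ.* (x i ℤ.* y i)) ℤ.+ ℤΣ.sum (λ i → t ℤ.* (x i ℤ.* z i))
    ≡⟨ sym (cong₂ ℤ._+_ (ℤΣ.*-distribˡ-sum s (λ i → x i ℤ.* y i)) (ℤΣ.*-distribˡ-sum t (λ i → x i ℤ.* z i))) ⟩
  s ℤ.* (x ∙ y) ℤ.+ t ℤ.* (x ∙ z) ∎
  where
  open ≡-Reasoning
  rearrange : ∀ s t x y z → x ℤ.* (s ℤ.* y ℤ.+ t ℤ.* z) ≡ s ℤ.* (x ℤ.* y) ℤ.+ t ℤ.* (x ℤ.* z)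
  rearrange = ℤ-Solver.solve-∀

∙-zeroʳ : ∀ {m} (x : Fin m → ℤ) → x ∙ (λ _ → 0ℤ) ≡ 0ℤ
∙-zeroʳ {m} x = trans (ℤΣ.sum-cong-≗ (ℤ.*-zeroʳ ∘ x)) (ℤΣ.sum-replicate-zero m)

∙-comm : ∀ {m} (x y : Fin m → ℤ) → x ∙ y ≡ y ∙ x
∙-comm x y = ℤΣ.sum-cong-≗ (λ i → ℤ.*-comm (x i) (y i))

infixr 5 _◂_
_◂_ : ∀ {m} → ℤ → (Fin m → ℤ) → Fin (suc m) → ℤ
(c ◂ x) zero    = c
(c ◂ x) (suc i) = x i

pivot? : ∀ {m} (rows : List (Fin (suc m) → ℤ)) →
  All (λ row → row zero ≡ 0ℤ) rows ⊎ (∃[ row ] row ∈ˡ rows × row zero ≢ 0ℤ)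
pivot? [] = inj₁ []
pivot? (row ∷ rows) with row zero ℤ.≟ 0ℤ | pivot? rows
... | no row₀≢0  | _                = inj₂ (row , here refl , row₀≢0)
... | yes row₀≡0 | inj₁ all         = inj₁ (row₀≡0 ∷ all)
... | yes _      | inj₂ (p , p∈ , p₀≢0) = inj₂ (p , there p∈ , p₀≢0)

-- Fraction-free elimination of the first unknown by means of the row p.
module Eliminate {m} (p : Fin (suc m) → ℤ) where

  reduce : (Fin (suc m) → ℤ) → Fin m → ℤ
  reduce x i = p zero ℤ.* x (suc i) ℤ.+ ℤ.- x zero ℤ.* p (suc i)

  extend : (Fin m → ℤ) → Fin (suc m) → ℤ
  extend z = ℤ.- ((p ∘ suc) ∙ z) ◂ λ i → p zero ℤ.* z i

  ∙-extend : ∀ x z → x ∙ extend z ≡ x zero ℤ.* ℤ.- ((p ∘ suc) ∙ z) ℤ.+ p zero ℤ.* ((x ∘ suc) ∙ z)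
  ∙-extend x z = cong (ℤ._+_ (x zero ℤ.* ℤ.- ((p ∘ suc) ∙ z)))
    (trans (ℤΣ.sum-cong-≗ (λ i → swap (x (suc i)) (p zero) (z i)))
           (sym (ℤΣ.*-distribˡ-sum (p zero) (λ i → x (suc i) ℤ.* z i))))
    where
    swap : ∀ a b c → a ℤ.* (b ℤ.* c) ≡ b ℤ.* (a ℤ.* c)
    swap = ℤ-Solver.solve-∀

  pivot-row : ∀ z → p ∙ extend z ≡ 0ℤ
  pivot-row z = trans (∙-extend p z) (cancel (p zero) ((p ∘ suc) ∙ z))
    where
    cancel : ∀ a b → a ℤ.* ℤ.- b ℤ.+ a ℤ.* b ≡ 0ℤ
    cancel = ℤ-Solver.solve-∀

  reduce-∙ : ∀ x z → x ∙ extend z ≡ reduce x ∙ z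
  reduce-∙ x z = begin
    x ∙ extend z
      ≡⟨ ∙-extend x z ⟩
    x zero ℤ.* ℤ.- ((p ∘ suc) ∙ z) ℤ.+ p zero ℤ.* ((x ∘ suc) ∙ z)
      ≡⟨ swap (x zero) ((p ∘ suc) ∙ z) (p zero) ((x ∘ suc) ∙ z) ⟩
    p zero ℤ.* ((x ∘ suc) ∙ z) ℤ.+ ℤ.- x zero ℤ.* ((p ∘ suc) ∙ z)
      ≡⟨ cong₂ (λ s t → p zero ℤ.* s ℤ.+ ℤ.- x zero ℤ.* t) (∙-comm (x ∘ suc) z) (∙-comm (p ∘ suc) z) ⟩
    p zero ℤ.* (z ∙ (x ∘ suc)) ℤ.+ ℤ.- x zero ℤ.* (z ∙ (p ∘ suc))
      ≡⟨ sym (∙-linear (p zero) (ℤ.- x zero) z (x ∘ suc) (p ∘ suc)) ⟩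
    z ∙ reduce x
      ≡⟨ ∙-comm z (reduce x) ⟩
    reduce x ∙ z ∎
    where
    open ≡-Reasoning
    swap : ∀ a b c d → a ℤ.* ℤ.- b ℤ.+ c ℤ.* d ≡ c ℤ.* d ℤ.+ ℤ.- a ℤ.* b
    swap = ℤ-Solver.solve-∀

kernel : ∀ {m} (rows : List (Fin m → ℤ)) → length rows < m →
  ∃[ z ] (∃[ i ] z i ≢ 0ℤ) × All (λ x → x ∙ z ≡ 0ℤ) rows
kernel {suc m} rows rows<m with pivot? rows
... | inj₁ heads≡0 = (1ℤ ◂ λ _ → 0ℤ) , (zero , λ ()) , All.map (λ {x} → unit x) heads≡0
  where
  unit : ∀ x → x zero ≡ 0ℤ → x ∙ (1ℤ ◂ λ _ → 0ℤ) ≡ 0ℤ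
  unit x x₀≡0 = trans (cong (ℤ._+_ (x zero ℤ.* 1ℤ)) (∙-zeroʳ (x ∘ suc)))
    (trans (ℤ.+-identityʳ (x zero ℤ.* 1ℤ)) (trans (ℤ.*-identityʳ (x zero)) x₀≡0))
... | inj₂ (p , p∈ , p₀≢0) with ∈-∃++ p∈
... | xs , ys , refl with kernel (map (Eliminate.reduce p) (xs ++ ys)) (short rows<m)
  where
  short : length (xs ++ p ∷ ys) < suc m → length (map (Eliminate.reduce p) (xs ++ ys)) < m
  short rows<m = s≤s⁻¹ (subst (λ k → suc k ≤ suc m) eq rows<m)
    where
    eq : length (xs ++ p ∷ ys) ≡ suc (length (map (Eliminate.reduce p) (xs ++ ys)))
    eq = trans (List.length-++ xs) (trans (ℕ.+-suc (length xs) (length ys))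
      (cong suc (sym (trans (List.length-map (Eliminate.reduce p) (xs ++ ys)) (List.length-++ xs)))))
... | z , (i , zᵢ≢0) , vanish = extend z , (suc i , nonzero) , All.++⁺ vxs (pivot-row z ∷ vys)
  where
  open Eliminate p
  nonzero : p zero ℤ.* z i ≢ 0ℤ
  nonzero eq with ℤ.i*j≡0⇒i≡0∨j≡0 (p zero) eq
  ... | inj₁ p₀≡0 = p₀≢0 p₀≡0
  ... | inj₂ zᵢ≡0 = zᵢ≢0 zᵢ≡0
  lifted : All (λ x → x ∙ extend z ≡ 0ℤ) (xs ++ ys)
  lifted = All.map (λ {x} → trans (reduce-∙ x z)) (All.map⁻ vanish)
  vxs = All.++⁻ˡ xs lifted
  vys = All.++⁻ʳ xs lifted

-- The least ratio c i / w i, cross-multiplied.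
argmin-ratio : ∀ {m} (c w : Fin m → ℕ) → (∃[ i ] w i ≢ 0) →
  ∃[ i ] w i ≢ 0 × (∀ j → c i * w j ≤ c j * w i)
argmin-ratio {suc m} c w (k , wₖ≢0) with Fin.any? (λ i → ¬? (w (suc i) ℕ.≟ 0))
... | no tail≡0 = zero , w₀≢0 k wₖ≢0 , least
  where
  tail-zero : ∀ i → w (suc i) ≡ 0
  tail-zero i with w (suc i) ℕ.≟ 0
  ... | yes eq = eq
  ... | no neq = contradiction (i , neq) tail≡0
  w₀≢0 : ∀ k → w k ≢ 0 → w zero ≢ 0
  w₀≢0 zero    w≢0 = w≢0
  w₀≢0 (suc i) w≢0 = contradiction (tail-zero i) w≢0
  least : ∀ j → c zero * w j ≤ c j * w zero
  least zero    = ℕ.≤-refl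
  least (suc j) rewrite tail-zero j | ℕ.*-zeroʳ (c zero) = z≤n
... | yes nz with argmin-ratio (c ∘ suc) (w ∘ suc) nz
... | i , wᵢ≢0 , least with w zero ℕ.≟ 0 | c (suc i) * w zero ℕ.≤? c zero * w (suc i)
... | _ | yes le = suc i , wᵢ≢0 , λ { zero → le ; (suc j) → least j }
... | yes w₀≡0 | no ≰ = contradiction (subst (λ x → c (suc i) * x ≤ c zero * w (suc i)) (sym w₀≡0) (ℕ.≤-trans (ℕ.≤-reflexive (ℕ.*-zeroʳ (c (suc i)))) z≤n)) ≰
... | no w₀≢0 | no ≰ = zero , w₀≢0 , λ { zero → ℕ.≤-refl ; (suc j) → transfer j }
  where
  a*c≤ = ℕ.<⇒≤ (ℕ.≰⇒> ≰)
  transfer : ∀ j → c zero * w (suc j) ≤ c (suc j) * w zero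
  -- Ratios are compared through that of `suc i`, whose denominator is nonzero and so can be
  -- cancelled.
  transfer j = ℕ.*-cancelʳ-≤ _ _ (w (suc i)) ⦃ ≢-nonZero wᵢ≢0 ⦄ (begin
    c zero * w (suc j) * w (suc i)      ≡⟨ swap (c zero) (w (suc j)) (w (suc i)) ⟩
    c zero * w (suc i) * w (suc j)      ≤⟨ ℕ.*-monoˡ-≤ (w (suc j)) a*c≤ ⟩
    c (suc i) * w zero * w (suc j)      ≡⟨ swap (c (suc i)) (w zero) (w (suc j)) ⟩
    c (suc i) * w (suc j) * w zero      ≤⟨ ℕ.*-monoˡ-≤ (w zero) (least j) ⟩
    c (suc j) * w (suc i) * w zero      ≡⟨ swap (c (suc j)) (w (suc i)) (w zero) ⟩
    c (suc j) * w zero * w (suc i)      ∎)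
    where
    open ℕ.≤-Reasoning
    swap : ∀ a b c → a * b * c ≡ a * c * b
    swap = solve-∀

-- Markov's inequality for counting: each listed index contributes at least `suc r` to the sum.
large-indices : ∀ {n} (f : Fin n → ℕ) r →
  ∃[ L ] (∀ v → r < f v → v ∈ˡ L) × length L * suc r ≤ sum f
large-indices {zero}  f r = [] , (λ ()) , z≤n
large-indices {suc n} f r with large-indices (f ∘ suc) r | r ℕ.<? f zero
... | L , large∈L , bound | yes r<f₀ = zero ∷ map suc L
  , (λ { zero _ → here refl ; (suc v) r<f → there (∈-map⁺ suc (large∈L v r<f)) })
  , ℕ.+-mono-≤ r<f₀ (subst (λ k → k * suc r ≤ _) (sym (List.length-map suc L)) bound)
... | L , large∈L , bound | no r≮f₀ = map suc L
  , (λ { zero r<f → contradiction r<f r≮f₀ ; (suc v) r<f → ∈-map⁺ suc (large∈L v r<f) })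
  , ℕ.≤-trans (subst (λ k → k * suc r ≤ _) (sym (List.length-map suc L)) bound) (ℕ.m≤n+m _ (f zero))

-- How far a may move in the direction of z inside the interval [0, N].
slack : ℕ → ℕ → ℤ → ℕ
slack N a (+ _)    = N ∸ a
slack N a -[1+ _ ] = a

-- a + (c / w) z, scaled by w.
shift : (w c a : ℕ) → ℤ → ℕ
shift w c a (+ k)    = w * a + c * k
shift w c a -[1+ k ] = w * a ∸ c * suc k

-- The hypothesis forbids overshooting the interval; for negative `z` it reads `c * ∣ z ∣ ≤ a * w`,
-- so the truncated subtraction in `shift` is exact.
shift-pos : ∀ w c N a z → c * ℤ.∣ z ∣ ≤ slack N a z * w →
  + shift w c a z ≡ + w ℤ.* + a ℤ.+ + c ℤ.* z
shift-pos w c N a (+ k) _ = cong₂ ℤ._+_ (ℤ.pos-* w a) (ℤ.pos-* c k)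
shift-pos w c N a -[1+ k ] le = begin
  + (w * a ∸ c * suc k)                  ≡⟨ sym (ℤ.⊖-≥ (ℕ.≤-trans le (ℕ.≤-reflexive (ℕ.*-comm a w)))) ⟩
  w * a ℤ.⊖ c * suc k                    ≡⟨ ℤ.m-n≡m⊖n (w * a) (c * suc k) ⟨
  + (w * a) ℤ.- + (c * suc k)            ≡⟨ cong₂ ℤ._-_ (ℤ.pos-* w a) (ℤ.pos-* c (suc k)) ⟩
  + w ℤ.* + a ℤ.- + c ℤ.* + suc k        ≡⟨ cong (ℤ._+_ (+ w ℤ.* + a)) (ℤ.neg-distribʳ-* (+ c) (+ suc k)) ⟩
  + w ℤ.* + a ℤ.+ + c ℤ.* -[1+ k ]       ∎
  where open ≡-Reasoning

shift≤ : ∀ w c N a z → a ≤ N → c * ℤ.∣ z ∣ ≤ slack N a z * w → shift w c a z ≤ w * N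
shift≤ w c N a (+ k) a≤N le = begin
  w * a + c * k          ≤⟨ ℕ.+-monoʳ-≤ (w * a) le ⟩
  w * a + (N ∸ a) * w    ≡⟨ cong (_+_ (w * a)) (ℕ.*-comm (N ∸ a) w) ⟩
  w * a + w * (N ∸ a)    ≡⟨ sym (ℕ.*-distribˡ-+ w a (N ∸ a)) ⟩
  w * (a + (N ∸ a))      ≡⟨ cong (w *_) (ℕ.m+[n∸m]≡n a≤N) ⟩
  w * N                  ∎
  where open ℕ.≤-Reasoning
shift≤ w c N a -[1+ k ] a≤N le = ℕ.≤-trans (ℕ.m∸n≤m (w * a) (c * suc k)) (ℕ.*-monoʳ-≤ w a≤N)

-- A coordinate that moves by its own ratio of slack to speed stops exactly at the end it was
-- heading for; `b` records which end.
shift-tight : ∀ N a z → a ≤ N → let s = shift ℤ.∣ z ∣ (slack N a z) a z in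
  ∃[ b ] s ≡ ℤ.∣ z ∣ * N * ⟦ b ⟧
shift-tight N a (+ k) a≤N = true , (begin
  k * a + (N ∸ a) * k    ≡⟨ cong (_+_ (k * a)) (ℕ.*-comm (N ∸ a) k) ⟩
  k * a + k * (N ∸ a)    ≡⟨ sym (ℕ.*-distribˡ-+ k a (N ∸ a)) ⟩
  k * (a + (N ∸ a))      ≡⟨ cong (k *_) (ℕ.m+[n∸m]≡n a≤N) ⟩
  k * N                  ≡⟨ sym (ℕ.*-identityʳ _) ⟩
  k * N * 1              ∎)
  where open ≡-Reasoning
shift-tight N a -[1+ k ] a≤N = false , trans
  (trans (cong (_∸ a * suc k) (ℕ.*-comm (suc k) a)) (ℕ.n∸n≡0 (a * suc k))) (sym (ℕ.*-zeroʳ (suc k * N)))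

row-sum : ∀ {m} → (Fin m → ℕ) → (Fin m → ℕ) → ℕ
row-sum x a = sum (λ e → x e * a e)

row-sum-pos : ∀ {m} (x a : Fin m → ℕ) → + row-sum x a ≡ (+_ ∘ x) ∙ (+_ ∘ a)
row-sum-pos x a = trans (pos-sum (λ e → x e * a e)) (ℤΣ.sum-cong-≗ (λ e → ℤ.pos-* (x e) (a e)))

row-sum≤ : ∀ {m} (x a : Fin m → ℕ) k → (∀ e → a e ≤ k) → row-sum x a ≤ sum x * k
row-sum≤ x a k a≤k = begin
  row-sum x a               ≤⟨ sum-mono (λ e → ℕ.*-monoʳ-≤ (x e) (a≤k e)) ⟩
  sum (λ e → x e * k)       ≡⟨ sym (*-distribʳ-sum k x) ⟩
  sum x * k                 ∎
  where open ℕ.≤-Reasoning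

-- Double counting: the total weight is at most `suc m * r`, and a heavy row carries at least
-- `suc r` of it. Having fewer heavy rows than columns is what gives a nonzero kernel vector.
heavy-rows : ∀ {m n} r (I : Fin n → Fin (suc m) → ℕ) → (∀ e → sum (λ v → I v e) ≤ r) →
  ∃[ L ] (∀ v → r < sum (I v) → v ∈ˡ L) × length L < suc m
heavy-rows {m} r I col≤r with large-indices (λ v → sum (I v)) r
... | L , complete , bound = L , complete , ℕ.*-cancelʳ-< (suc r) (length L) (suc m) (begin-strict
  length L * suc r                  ≤⟨ bound ⟩
  sum (λ v → sum (I v))             ≡⟨ ∑-comm I ⟩
  sum (λ e → sum (λ v → I v e))     ≤⟨ sum≤n*bound (λ e → sum (λ v → I v e)) r col≤r ⟩
  suc m * r                         <⟨ ℕ.*-monoʳ-< (suc m) (ℕ.n<1+n r) ⟩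
  suc m * suc r                     ∎)
  where open ℕ.≤-Reasoning

kernel-heavy : ∀ {m n} r (I : Fin n → Fin (suc m) → ℕ) → (∀ e → sum (λ v → I v e) ≤ r) →
  ∃[ z ] (∃[ e ] ℤ.∣ z e ∣ ≢ 0) × (∀ v → r < sum (I v) → (+_ ∘ I v) ∙ z ≡ 0ℤ)
kernel-heavy {m} r I col≤r with heavy-rows r I col≤r
... | L , complete , few
  with kernel (map (λ v → +_ ∘ I v) L) (subst (_< suc m) (sym (List.length-map (λ v → +_ ∘ I v) L)) few)
... | z , (e , zₑ≢0) , vanish =
  z , (e , zₑ≢0 ∘ ℤ.∣i∣≡0⇒i≡0) , λ v heavy → All.lookup (All.map⁻ vanish) (complete v heavy)

-- Moving the weights a along a kernel vector until one of them reaches an end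
-- of [0, N]; the new weights are scaled by w.
record Push {m n} (r : ℕ) (I : Fin n → Fin (suc m) → ℕ) (N : ℕ) (a : Fin (suc m) → ℕ) : Set where
  field
    w      : ℕ
    w≢0    : w ≢ 0
    a′     : Fin (suc m) → ℕ
    a′≤wN  : ∀ e → a′ e ≤ w * N
    e*     : Fin (suc m)
    end    : Bool
    tight  : a′ e* ≡ w * N * ⟦ end ⟧
    heavy  : ∀ v → r < sum (I v) → row-sum (I v) a′ ≡ w * row-sum (I v) a

push : ∀ {m n} r (I : Fin n → Fin (suc m) → ℕ) → (∀ e → sum (λ v → I v e) ≤ r) →
  ∀ N (a : Fin (suc m) → ℕ) → (∀ e → a e ≤ N) → Push r I N a
push {m} r I col≤r N a a≤N with kernel-heavy r I col≤r
-- The coordinate with the least slack per unit of speed is the first to reach an end, so stopping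
-- there keeps every weight in `[0, N]`.
... | z , z≢0 , I∙z≡0 with argmin-ratio (λ e → slack N (a e) (z e)) (λ e → ℤ.∣ z e ∣) z≢0
... | e* , w≢0 , feasible = record
  { w = w ; w≢0 = w≢0 ; a′ = a′
  ; a′≤wN = λ e → shift≤ w c N (a e) (z e) (a≤N e) (feasible e)
  ; e* = e* ; end = proj₁ (shift-tight N (a e*) (z e*) (a≤N e*))
  ; tight = proj₂ (shift-tight N (a e*) (z e*) (a≤N e*))
  ; heavy = λ v r<Iv → ℤ.+-injective (begin
      + row-sum (I v) a′                          ≡⟨ row-sum-pos (I v) a′ ⟩
      ι v ∙ (+_ ∘ a′)                             ≡⟨ ℤΣ.sum-cong-≗ (λ e → cong (ι v e ℤ.*_) (shift-pos w c N (a e) (z e) (feasible e))) ⟩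
      ι v ∙ (λ e → + w ℤ.* + a e ℤ.+ + c ℤ.* z e) ≡⟨ ∙-linear (+ w) (+ c) (ι v) (+_ ∘ a) z ⟩
      + w ℤ.* (ι v ∙ (+_ ∘ a)) ℤ.+ + c ℤ.* (ι v ∙ z)
        ≡⟨ cong₂ (λ s t → + w ℤ.* s ℤ.+ + c ℤ.* t) (sym (row-sum-pos (I v) a)) (I∙z≡0 v r<Iv) ⟩
      + w ℤ.* + row-sum (I v) a ℤ.+ + c ℤ.* 0ℤ    ≡⟨ drop (+ w ℤ.* + row-sum (I v) a) (+ c) ⟩
      + w ℤ.* + row-sum (I v) a                   ≡⟨ sym (ℤ.pos-* w (row-sum (I v) a)) ⟩
      + (w * row-sum (I v) a)                     ∎)
  }
  where
  open ≡-Reasoning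
  w = ℤ.∣ z e* ∣
  c = slack N (a e*) (z e*)
  a′ : Fin (suc m) → ℕ
  a′ e = shift w c (a e) (z e)
  ι : ∀ v → Fin (suc m) → ℤ
  ι v = +_ ∘ I v
  drop : ∀ s c → s ℤ.+ c ℤ.* 0ℤ ≡ s
  drop = ℤ-Solver.solve-∀

row-sum-insert : ∀ {m} (x : Fin (suc m) → ℕ) e* (χ : Fin m → Bool) b N →
  N * row-sum x (⟦_⟧ ∘ insertAt χ e* b) ≡ x e* * (N * ⟦ b ⟧) + N * row-sum (x ∘ punchIn e*) (⟦_⟧ ∘ χ)
row-sum-insert x e* χ b N = begin
  N * row-sum x (⟦_⟧ ∘ χ⁺)
    ≡⟨ cong (N *_) (sum-remove {i = e*} (λ e → x e * ⟦ χ⁺ e ⟧)) ⟩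
  N * (x e* * ⟦ χ⁺ e* ⟧ + row-sum (x ∘ punchIn e*) (⟦_⟧ ∘ χ⁺ ∘ punchIn e*))
    ≡⟨ cong₂ (λ b s → N * (x e* * ⟦ b ⟧ + s)) (insertAt-lookup χ e* b)
         (sum-cong-≗ (λ e → cong (λ b → x (punchIn e* e) * ⟦ b ⟧) (insertAt-punchIn χ e* b e))) ⟩
  N * (x e* * ⟦ b ⟧ + row-sum (x ∘ punchIn e*) (⟦_⟧ ∘ χ))
    ≡⟨ rearrange N (x e*) ⟦ b ⟧ (row-sum (x ∘ punchIn e*) (⟦_⟧ ∘ χ)) ⟩
  x e* * (N * ⟦ b ⟧) + N * row-sum (x ∘ punchIn e*) (⟦_⟧ ∘ χ) ∎
  where
  open ≡-Reasoning
  χ⁺ = insertAt χ e* b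
  rearrange : ∀ N x b s → N * (x * b + s) ≡ x * (N * b) + N * s
  rearrange = solve-∀

-- Beck and Fiala: a row of weight at most r satisfies the conclusion for every
-- choice of χ, and the other rows are fewer than the columns.
rounding : ∀ {m n} r (I : Fin n → Fin m → ℕ) → (∀ e → sum (λ v → I v e) ≤ r) →
  ∀ N (a : Fin m → ℕ) → (∀ e → a e ≤ N) →
  ∃[ χ ] (∀ v → N * row-sum (I v) (⟦_⟧ ∘ χ) ≤ row-sum (I v) a + N * r
              × row-sum (I v) a ≤ N * row-sum (I v) (⟦_⟧ ∘ χ) + N * r)
rounding {zero} r I col≤r N a a≤N = (λ ()) , λ v → ℕ.≤-trans (ℕ.≤-reflexive (ℕ.*-zeroʳ N)) z≤n , z≤n
rounding {suc m} {n} r I col≤r N a a≤N with push r I col≤r N a a≤N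
... | record { w = w ; w≢0 = w≢0 ; a′ = a′ ; a′≤wN = a′≤wN ; e* = e* ; end = end ; tight = tight ; heavy = heavy }
  -- The weights are fractions over the denominator `N`. The push turns it into `w * N`, and the
  -- column `e*`, now integral, is frozen and deleted.
  with rounding r (λ v → I v ∘ punchIn e*) (col≤r ∘ punchIn e*) (w * N) (a′ ∘ punchIn e*) (a′≤wN ∘ punchIn e*)
... | χ , bounds = χ⁺ , bounds⁺
  where
  χ⁺ = insertAt χ e* end
  chosen chosen⁻ row⁻ : Fin n → ℕ
  chosen v = row-sum (I v) (⟦_⟧ ∘ χ⁺)
  chosen⁻ v = row-sum (I v ∘ punchIn e*) (⟦_⟧ ∘ χ)
  row⁻ v = row-sum (I v ∘ punchIn e*) (a′ ∘ punchIn e*)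

  row-split : ∀ v → row-sum (I v) a′ ≡ I v e* * a′ e* + row⁻ v
  row-split v = sum-remove {i = e*} (λ e → I v e * a′ e)
  chosen-split : ∀ v → w * N * chosen v ≡ I v e* * a′ e* + w * N * chosen⁻ v
  chosen-split v = trans (row-sum-insert (I v) e* χ end (w * N))
    (cong (λ s → I v e* * s + w * N * chosen⁻ v) (sym tight))

  light-bounds : ∀ v → sum (I v) ≤ r → N * chosen v ≤ N * r × row-sum (I v) a ≤ N * r
  light-bounds v light =
      ℕ.*-monoʳ-≤ N (subst (chosen v ≤_) (ℕ.*-identityʳ r)
        (ℕ.≤-trans (row-sum≤ (I v) (⟦_⟧ ∘ χ⁺) 1 (⟦⟧≤1 ∘ χ⁺)) (ℕ.*-monoˡ-≤ 1 light)))
    , subst (row-sum (I v) a ≤_) (ℕ.*-comm r N)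
        (ℕ.≤-trans (row-sum≤ (I v) a N a≤N) (ℕ.*-monoˡ-≤ N light))

  upper : ∀ v → r < sum (I v) → N * chosen v ≤ row-sum (I v) a + N * r
  upper v r<Iv = ℕ.*-cancelˡ-≤ w ⦃ ≢-nonZero w≢0 ⦄ (begin
    w * (N * chosen v)                            ≡⟨ sym (ℕ.*-assoc w N (chosen v)) ⟩
    w * N * chosen v                              ≡⟨ chosen-split v ⟩
    I v e* * a′ e* + w * N * chosen⁻ v            ≤⟨ ℕ.+-monoʳ-≤ (I v e* * a′ e*) (proj₁ (bounds v)) ⟩
    I v e* * a′ e* + (row⁻ v + w * N * r)         ≡⟨ sym (ℕ.+-assoc (I v e* * a′ e*) (row⁻ v) (w * N * r)) ⟩
    I v e* * a′ e* + row⁻ v + w * N * r           ≡⟨ cong (_+ w * N * r) (sym (row-split v)) ⟩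
    row-sum (I v) a′ + w * N * r                  ≡⟨ cong₂ _+_ (heavy v r<Iv) (ℕ.*-assoc w N r) ⟩
    w * row-sum (I v) a + w * (N * r)             ≡⟨ sym (ℕ.*-distribˡ-+ w (row-sum (I v) a) (N * r)) ⟩
    w * (row-sum (I v) a + N * r)                 ∎)
    where open ℕ.≤-Reasoning

  lower : ∀ v → r < sum (I v) → row-sum (I v) a ≤ N * chosen v + N * r
  lower v r<Iv = ℕ.*-cancelˡ-≤ w ⦃ ≢-nonZero w≢0 ⦄ (begin
    w * row-sum (I v) a                           ≡⟨ sym (heavy v r<Iv) ⟩
    row-sum (I v) a′                              ≡⟨ row-split v ⟩
    I v e* * a′ e* + row⁻ v                       ≤⟨ ℕ.+-monoʳ-≤ (I v e* * a′ e*) (proj₂ (bounds v)) ⟩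
    I v e* * a′ e* + (w * N * chosen⁻ v + w * N * r)  ≡⟨ sym (ℕ.+-assoc (I v e* * a′ e*) (w * N * chosen⁻ v) (w * N * r)) ⟩
    I v e* * a′ e* + w * N * chosen⁻ v + w * N * r    ≡⟨ cong (_+ w * N * r) (sym (chosen-split v)) ⟩
    w * N * chosen v + w * N * r                  ≡⟨ cong₂ _+_ (ℕ.*-assoc w N (chosen v)) (ℕ.*-assoc w N r) ⟩
    w * (N * chosen v) + w * (N * r)              ≡⟨ sym (ℕ.*-distribˡ-+ w (N * chosen v) (N * r)) ⟩
    w * (N * chosen v + N * r)                    ∎)
    where open ℕ.≤-Reasoning

  bounds⁺ : ∀ v → N * chosen v ≤ row-sum (I v) a + N * r × row-sum (I v) a ≤ N * chosen v + N * r
  -- A light row is settled at once, as the push may change its sum arbitrarily; only heavy rows,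
  -- whose sums are preserved, rely on the recursive call.
  bounds⁺ v with r ℕ.<? sum (I v)
  ... | yes r<Iv = upper v r<Iv , lower v r<Iv
  ... | no r≮Iv with light-bounds v (ℕ.≮⇒≥ r≮Iv)
  ... | χ≤ , a≤ = ℕ.≤-trans χ≤ (ℕ.m≤n+m (N * r) (row-sum (I v) a))
                , ℕ.≤-trans a≤ (ℕ.m≤n+m (N * r) (N * chosen v))

-- The local lemma

DependsOn : ∀ {m} → (Fin m → Set) → (Vec Bool m → ℕ) → Set
DependsOn P f = ∀ χ χ′ → (∀ e → P e → lookup χ e ≡ lookup χ′ e) → f χ ≡ f χ′

-- 𝔼 is q ^ m times the expectation when each of the m bits is true with
-- probability 1 / q independently, where q = suc p.
module Weighted (p : ℕ) where

  q : ℕ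
  q = suc p

  𝔼 : ∀ {m} → (Vec Bool m → ℕ) → ℕ
  𝔼 {zero}  f = f []
  𝔼 {suc m} f = 𝔼 (λ χ → f (true ∷ χ)) + p * 𝔼 (λ χ → f (false ∷ χ))

  𝔼-cong : ∀ {m} {f g : Vec Bool m → ℕ} → (∀ χ → f χ ≡ g χ) → 𝔼 f ≡ 𝔼 g
  𝔼-cong {zero}  f≡g = f≡g []
  𝔼-cong {suc m} f≡g = cong₂ (λ s t → s + p * t) (𝔼-cong (λ χ → f≡g (true ∷ χ))) (𝔼-cong (λ χ → f≡g (false ∷ χ)))

  𝔼-mono : ∀ {m} {f g : Vec Bool m → ℕ} → (∀ χ → f χ ≤ g χ) → 𝔼 f ≤ 𝔼 g
  𝔼-mono {zero}  f≤g = f≤g []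
  𝔼-mono {suc m} f≤g = ℕ.+-mono-≤ (𝔼-mono (λ χ → f≤g (true ∷ χ))) (ℕ.*-monoʳ-≤ p (𝔼-mono (λ χ → f≤g (false ∷ χ))))

  𝔼-+ : ∀ {m} (f g : Vec Bool m → ℕ) → 𝔼 (λ χ → f χ + g χ) ≡ 𝔼 f + 𝔼 g
  𝔼-+ {zero}  f g = refl
  𝔼-+ {suc m} f g = trans
    (cong₂ (λ s t → s + p * t) (𝔼-+ (λ χ → f (true ∷ χ)) (λ χ → g (true ∷ χ))) (𝔼-+ (λ χ → f (false ∷ χ)) (λ χ → g (false ∷ χ))))
    (rearrange p (𝔼 (λ χ → f (true ∷ χ))) (𝔼 (λ χ → g (true ∷ χ))) (𝔼 (λ χ → f (false ∷ χ))) (𝔼 (λ χ → g (false ∷ χ))))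
    where
    rearrange : ∀ p a b c d → a + b + p * (c + d) ≡ a + p * c + (b + p * d)
    rearrange = solve-∀

  𝔼-* : ∀ {m} c (f : Vec Bool m → ℕ) → 𝔼 (λ χ → c * f χ) ≡ c * 𝔼 f
  𝔼-* {zero}  c f = refl
  𝔼-* {suc m} c f = trans
    (cong₂ (λ s t → s + p * t) (𝔼-* c (λ χ → f (true ∷ χ))) (𝔼-* c (λ χ → f (false ∷ χ))))
    (rearrange p c (𝔼 (λ χ → f (true ∷ χ))) (𝔼 (λ χ → f (false ∷ χ))))
    where
    rearrange : ∀ p c a b → c * a + p * (c * b) ≡ c * (a + p * b)
    rearrange = solve-∀

  𝔼-sum : ∀ {m n} (c : Fin n → ℕ) (f : Fin n → Vec Bool m → ℕ) →
    𝔼 (λ χ → sum (λ u → c u * f u χ)) ≡ sum (λ u → c u * 𝔼 (f u))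
  𝔼-sum {m} {zero}  c f = 𝔼-* {m} 0 (λ _ → 0)
  𝔼-sum {m} {suc n} c f = trans (𝔼-+ (λ χ → c zero * f zero χ) (λ χ → sum (λ u → c (suc u) * f (suc u) χ)))
    (cong₂ _+_ (𝔼-* (c zero) (f zero)) (𝔼-sum (c ∘ suc) (f ∘ suc)))

  𝔼-1 : ∀ m → 𝔼 {m} (λ _ → 1) ≡ q ^ m
  𝔼-1 zero    = refl
  𝔼-1 (suc m) rewrite 𝔼-1 m = refl

  𝔼-witness : ∀ {m} (f : Vec Bool m → ℕ) → 0 < 𝔼 f → ∃[ χ ] 0 < f χ
  𝔼-witness {zero}  f 0<f = [] , 0<f
  𝔼-witness {suc m} f 0<𝔼 with 𝔼 (λ χ → f (true ∷ χ)) in eq₁ | 𝔼 (λ χ → f (false ∷ χ)) in eq₀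
  ... | suc _ | _ with 𝔼-witness (λ χ → f (true ∷ χ)) (subst (0 <_) (sym eq₁) (s≤s z≤n))
  ...   | χ , 0<f = true ∷ χ , 0<f
  𝔼-witness {suc m} f 0<𝔼 | zero | suc _ with 𝔼-witness (λ χ → f (false ∷ χ)) (subst (0 <_) (sym eq₀) (s≤s z≤n))
  ...   | χ , 0<f = false ∷ χ , 0<f
  𝔼-witness {suc m} f 0<𝔼 | zero | zero = contradiction (subst (0 <_) (ℕ.*-zeroʳ p) 0<𝔼) λ ()

  DependsOn-∷ : ∀ {m} {P : Fin (suc m) → Set} {f : Vec Bool (suc m) → ℕ} b →
    DependsOn P f → DependsOn (P ∘ suc) (λ χ → f (b ∷ χ))
  DependsOn-∷ b dep χ χ′ agree = dep (b ∷ χ) (b ∷ χ′) λ { zero _ → refl ; (suc e) Pe → agree e Pe }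

  irrelevant-head : ∀ {m} {P : Fin (suc m) → Set} {f : Vec Bool (suc m) → ℕ} →
    DependsOn P f → ¬ P zero → ∀ χ → f (false ∷ χ) ≡ f (true ∷ χ)
  irrelevant-head dep ¬P₀ χ = dep (false ∷ χ) (true ∷ χ) λ { zero P₀ → contradiction P₀ ¬P₀ ; (suc e) _ → refl }

  -- Every coordinate is ignored by `f` or by `g`. The two branches of the factor that ignores it
  -- coincide, and their total weight `1 + p` is the extra `q` on the left.
  𝔼-independent : ∀ {m} (X : Fin m → ℕ) (f g : Vec Bool m → ℕ) →
    DependsOn (λ e → X e ≢ 0) f → DependsOn (λ e → X e ≡ 0) g →
    q ^ m * 𝔼 (λ χ → f χ * g χ) ≡ 𝔼 f * 𝔼 g
  𝔼-independent {zero}  X f g depf depg = ℕ.*-identityˡ (f [] * g [])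
  𝔼-independent {suc m} X f g depf depg = by-head (X zero ℕ.≟ 0)
    where
    open ≡-Reasoning
    f₁ f₀ g₁ g₀ : Vec Bool m → ℕ
    f₁ χ = f (true ∷ χ)
    f₀ χ = f (false ∷ χ)
    g₁ χ = g (true ∷ χ)
    g₀ χ = g (false ∷ χ)
    IH : ∀ b c → q ^ m * 𝔼 (λ χ → f (b ∷ χ) * g (c ∷ χ)) ≡ 𝔼 (λ χ → f (b ∷ χ)) * 𝔼 (λ χ → g (c ∷ χ))
    IH b c = 𝔼-independent (X ∘ suc) (λ χ → f (b ∷ χ)) (λ χ → g (c ∷ χ))
      (DependsOn-∷ {P = λ e → X e ≢ 0} b depf) (DependsOn-∷ {P = λ e → X e ≡ 0} c depg)
    split : q * q ^ m * (𝔼 (λ χ → f₁ χ * g₁ χ) + p * 𝔼 (λ χ → f₀ χ * g₀ χ)) ≡ q * (𝔼 f₁ * 𝔼 g₁ + p * (𝔼 f₀ * 𝔼 g₀))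
    split = trans (rearrange p (q ^ m) (𝔼 (λ χ → f₁ χ * g₁ χ)) (𝔼 (λ χ → f₀ χ * g₀ χ)))
      (cong₂ (λ s t → q * (s + p * t)) (IH true true) (IH false false))
      where
      rearrange : ∀ p Q a b → suc p * Q * (a + p * b) ≡ suc p * (Q * a + p * (Q * b))
      rearrange = solve-∀
    by-head : Dec (X zero ≡ 0) → q * q ^ m * (𝔼 (λ χ → f₁ χ * g₁ χ) + p * 𝔼 (λ χ → f₀ χ * g₀ χ)) ≡ (𝔼 f₁ + p * 𝔼 f₀) * (𝔼 g₁ + p * 𝔼 g₀)
    by-head (yes X₀≡0) = trans split (subst
      (λ F → q * (𝔼 f₁ * 𝔼 g₁ + p * (F * 𝔼 g₀)) ≡ (𝔼 f₁ + p * F) * (𝔼 g₁ + p * 𝔼 g₀))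
      (sym (𝔼-cong {f = f₀} {g = f₁} (irrelevant-head {P = λ e → X e ≢ 0} depf (λ X₀≢0 → X₀≢0 X₀≡0))))
      (rearrange p (𝔼 f₁) (𝔼 g₁) (𝔼 g₀)))
      where
      rearrange : ∀ p F a b → suc p * (F * a + p * (F * b)) ≡ (F + p * F) * (a + p * b)
      rearrange = solve-∀
    by-head (no X₀≢0) = trans split (subst
      (λ G → q * (𝔼 f₁ * 𝔼 g₁ + p * (𝔼 f₀ * G)) ≡ (𝔼 f₁ + p * 𝔼 f₀) * (𝔼 g₁ + p * G))
      (sym (𝔼-cong {f = g₀} {g = g₁} (irrelevant-head {P = λ e → X e ≡ 0} depg X₀≢0)))
      (rearrange p (𝔼 f₁) (𝔼 f₀) (𝔼 g₁)))
      where
      rearrange : ∀ p a b G → suc p * (a * G + p * (b * G)) ≡ (a + p * b) * (G + p * G)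
      rearrange = solve-∀

  -- The generating function of a binomial variable, with both sides multiplied
  -- so that no subtraction occurs.
  𝔼-moment : ∀ {m} (b : Fin m → Bool) x →
    𝔼 (λ χ → x ^ row-sum (⟦_⟧ ∘ b) (⟦_⟧ ∘ lookup χ)) * q ^ sum (⟦_⟧ ∘ b) ≡ (x + p) ^ sum (⟦_⟧ ∘ b) * q ^ m
  𝔼-moment {zero}  b x = refl
  𝔼-moment {suc m} b x with b zero
  ... | true  = begin
    (𝔼 (λ χ → x * F χ) + p * E′) * (q * Q)      ≡⟨ cong (λ s → (s + p * E′) * (q * Q)) (𝔼-* x F) ⟩
    (x * E′ + p * E′) * (q * Q)                 ≡⟨ rearrange x p E′ Q ⟩
    (x + p) * (E′ * Q) * q                      ≡⟨ cong (λ s → (x + p) * s * q) (𝔼-moment (b ∘ suc) x) ⟩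
    (x + p) * (Y * q ^ m) * q                   ≡⟨ rearrange′ (x + p) Y (q ^ m) q ⟩
    (x + p) * Y * (q * q ^ m)                   ∎
    where
    open ≡-Reasoning
    F : Vec Bool m → ℕ
    F χ = x ^ row-sum (⟦_⟧ ∘ b ∘ suc) (⟦_⟧ ∘ lookup χ)
    E′ = 𝔼 F
    Q = q ^ sum (⟦_⟧ ∘ b ∘ suc)
    Y = (x + p) ^ sum (⟦_⟧ ∘ b ∘ suc)
    rearrange : ∀ x p E Q → (x * E + p * E) * (suc p * Q) ≡ (x + p) * (E * Q) * suc p
    rearrange = solve-∀
    rearrange′ : ∀ s Y Q q → s * (Y * Q) * q ≡ s * Y * (q * Q)
    rearrange′ = solve-∀
  ... | false = begin
    (E′ + p * E′) * Q                           ≡⟨ rearrange p E′ Q ⟩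
    q * (E′ * Q)                                ≡⟨ cong (q *_) (𝔼-moment (b ∘ suc) x) ⟩
    q * (Y * q ^ m)                             ≡⟨ rearrange′ q Y (q ^ m) ⟩
    Y * (q * q ^ m)                             ∎
    where
    open ≡-Reasoning
    E′ = 𝔼 (λ χ → x ^ row-sum (⟦_⟧ ∘ b ∘ suc) (⟦_⟧ ∘ lookup χ))
    Q = q ^ sum (⟦_⟧ ∘ b ∘ suc)
    Y = (x + p) ^ sum (⟦_⟧ ∘ b ∘ suc)
    rearrange : ∀ p E Q → (E + p * E) * Q ≡ suc p * (E * Q)
    rearrange = solve-∀
    rearrange′ : ∀ q Y Q → q * (Y * Q) ≡ Y * (q * Q)
    rearrange′ = solve-∀

sum-point : ∀ {n} (v : Fin n) → sum (λ u → ⟦ does (u Fin.≟ v) ⟧) ≡ 1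
sum-point {suc n} zero    = cong suc (sum-replicate-zero n)
sum-point {suc n} (suc v) = sum-point v

true⇒holds : ∀ {P : Set} (P? : Dec P) → does P? ≡ true → P
true⇒holds (yes P) refl = P

⟦does⟧-mono : ∀ {P Q : Set} (P? : Dec P) (Q? : Dec Q) → (P → Q) → ⟦ does P? ⟧ ≤ ⟦ does Q? ⟧
⟦does⟧-mono (no _)  Q?      P⇒Q = z≤n
⟦does⟧-mono (yes _) (yes _) P⇒Q = ℕ.≤-refl
⟦does⟧-mono (yes P) (no ¬Q) P⇒Q = contradiction (P⇒Q P) ¬Q

module LocalLemma {m n : ℕ} (p : ℕ) (I : Fin n → Fin m → ℕ) (bad : Fin n → Vec Bool m → Bool)
  (local : ∀ v → DependsOn (λ e → I v e ≢ 0) (λ χ → ⟦ bad v χ ⟧))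
  where

  open Weighted p

  -- Zero exactly when the two supports are disjoint. Being a count and not a relation, it serves
  -- directly as coefficients in `union-bound`, and double counting bounds its sum.
  near : Fin n → Fin n → ℕ
  near v u = row-sum (I v) (I u)

  near≡0⇒disjoint : ∀ v u → near v u ≡ 0 → ∀ e → I u e ≢ 0 → I v e ≡ 0
  near≡0⇒disjoint v u near≡0 e Iue≢0 with ℕ.m*n≡0⇒m≡0∨n≡0 (I v e) (ℕ.n≤0⇒n≡0 (subst (_ ≤_) near≡0 (term≤sum (λ e → I v e * I u e) e)))
  ... | inj₁ Ive≡0 = Ive≡0
  ... | inj₂ Iue≡0 = contradiction Iue≡0 Iue≢0

  Clear : Subset n → Vec Bool m → Set
  Clear S χ = ∀ u → u ∈ S → ⟦ bad u χ ⟧ ≡ 0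

  abstract
    clear? : ∀ S χ → Dec (Clear S χ)
    clear? S χ = Fin.all? (λ u → (u ∈? S) →-dec (⟦ bad u χ ⟧ ℕ.≟ 0))

  clear : Subset n → Vec Bool m → ℕ
  clear S χ = ⟦ does (clear? S χ) ⟧

  clear-anti : ∀ {S T} → S ⊆ˢ T → ∀ χ → clear T χ ≤ clear S χ
  clear-anti {S} {T} S⊆T χ = ⟦does⟧-mono (clear? T χ) (clear? S χ) (λ ok u u∈S → ok u (S⊆T u∈S))

  clear-depends : ∀ {P : Fin m → Set} S → (∀ u → u ∈ S → DependsOn P (λ χ → ⟦ bad u χ ⟧)) → DependsOn P (clear S)
  clear-depends S dep χ χ′ agree = ℕ.≤-antisym
    (⟦does⟧-mono (clear? S χ) (clear? S χ′) (λ ok u u∈S → trans (sym (dep u u∈S χ χ′ agree)) (ok u u∈S)))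
    (⟦does⟧-mono (clear? S χ′) (clear? S χ) (λ ok u u∈S → trans (dep u u∈S χ χ′ agree) (ok u u∈S)))

  -- If `T` is clear and `S` is not, some `u` of `S` is bad. It is not in `T`, so `c u` is positive
  -- and pays for it. The coefficients will be `near v`, or the indicator of a single vertex.
  union-bound : ∀ S T (c : Fin n → ℕ) → (∀ u → u ∈ S → c u ≡ 0 → u ∈ T) →
    𝔼 (clear T) ≤ 𝔼 (clear S) + sum (λ u → c u * 𝔼 (λ χ → ⟦ bad u χ ⟧ * clear T χ))
  union-bound S T c S∖c⊆T = subst (𝔼 (clear T) ≤_)
    (trans (𝔼-+ (clear S) (λ χ → sum (λ u → c u * (⟦ bad u χ ⟧ * clear T χ))))
           (cong (λ x → 𝔼 (clear S) + x) (𝔼-sum c (λ u χ → ⟦ bad u χ ⟧ * clear T χ))))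
    (𝔼-mono pointwise)
    where
    pointwise : ∀ χ → clear T χ ≤ clear S χ + sum (λ u → c u * (⟦ bad u χ ⟧ * clear T χ))
    pointwise χ with clear? T χ | clear? S χ
    ... | no _  | _     = z≤n
    ... | yes _ | yes _ = s≤s z≤n
    ... | yes T-ok | no S-not with Fin.¬∀⟶∃¬ n (λ u → u ∈ S → ⟦ bad u χ ⟧ ≡ 0) (λ u → (u ∈? S) →-dec (⟦ bad u χ ⟧ ℕ.≟ 0)) S-not
    ... | u , ¬ok = ℕ.≤-trans (positive (c u) (⟦ bad u χ ⟧) cu≢0 bad≢0) (term≤sum (λ u → c u * (⟦ bad u χ ⟧ * 1)) u)
      where
      bad≢0 : ⟦ bad u χ ⟧ ≢ 0
      bad≢0 eq = ¬ok λ _ → eq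
      cu≢0 : c u ≢ 0
      cu≢0 eq = ¬ok λ u∈S → T-ok u (S∖c⊆T u u∈S eq)
      positive : ∀ a b → a ≢ 0 → b ≢ 0 → 1 ≤ a * (b * 1)
      positive zero    b       a≢0 b≢0 = contradiction refl a≢0
      positive (suc a) zero    a≢0 b≢0 = contradiction refl b≢0
      positive (suc a) (suc b) a≢0 b≢0 = s≤s z≤n

  far : Fin n → Subset n → Subset n
  far v S = S ∩ Vec.tabulate (λ u → does (near v u ℕ.≟ 0))

  ∈far⁺ : ∀ v S u → u ∈ S → near v u ≡ 0 → u ∈ far v S
  ∈far⁺ v S u u∈S near≡0 = x∈p∩q⁺ (u∈S , lookup⇒[]= u _
    (trans (lookup∘tabulate (λ u → does (near v u ℕ.≟ 0)) u) (dec-true (near v u ℕ.≟ 0) near≡0)))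

  ∈far⇒near≡0 : ∀ v S u → u ∈ far v S → near v u ≡ 0
  ∈far⇒near≡0 v S u u∈ = true⇒holds (near v u ℕ.≟ 0)
    (trans (sym (lookup∘tabulate (λ u → does (near v u ℕ.≟ 0)) u)) ([]=⇒lookup (p∩q⊆q S _ u∈)))

  far⊆ : ∀ v S → far v S ⊆ˢ S
  far⊆ v S = p∩q⊆p S (Vec.tabulate (λ u → does (near v u ℕ.≟ 0)))

  module _ (K Δ : ℕ) (0<K : 0 < K) (4Δ≤K : 4 * Δ ≤ K)
    (rare : ∀ v → K * 𝔼 (λ χ → ⟦ bad v χ ⟧) ≤ q ^ m)
    (sparse : ∀ v → sum (near v) ≤ Δ) where

    private instance K≢0 = >-nonZero 0<K

    -- Conditionally on S being clear, every bad event has probability at most 2 / K.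
    Rare : Subset n → Set
    Rare S = ∀ v → K * 𝔼 (λ χ → ⟦ bad v χ ⟧ * clear S χ) ≤ 2 * 𝔼 (clear S)

    -- The events in `far v S` use only coordinates outside the support of `I v`, so conditioning on
    -- them leaves the probability of `bad v` unchanged.
    far-rare : ∀ v S → K * 𝔼 (λ χ → ⟦ bad v χ ⟧ * clear (far v S) χ) ≤ 𝔼 (clear (far v S))
    far-rare v S = ℕ.*-cancelˡ-≤ (q ^ m) ⦃ ℕ.m^n≢0 q m ⦄ (begin
      q ^ m * (K * 𝔼 (λ χ → ⟦ bad v χ ⟧ * clear T χ))    ≡⟨ swap (q ^ m) K (𝔼 (λ χ → ⟦ bad v χ ⟧ * clear T χ)) ⟩
      K * (q ^ m * 𝔼 (λ χ → ⟦ bad v χ ⟧ * clear T χ))    ≡⟨ cong (K *_) (𝔼-independent (I v) (λ χ → ⟦ bad v χ ⟧) (clear T) (local v) T-dep) ⟩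
      K * (𝔼 (λ χ → ⟦ bad v χ ⟧) * 𝔼 (clear T))          ≡⟨ sym (ℕ.*-assoc K (𝔼 (λ χ → ⟦ bad v χ ⟧)) (𝔼 (clear T))) ⟩
      K * 𝔼 (λ χ → ⟦ bad v χ ⟧) * 𝔼 (clear T)            ≤⟨ ℕ.*-monoˡ-≤ (𝔼 (clear T)) (rare v) ⟩
      q ^ m * 𝔼 (clear T)                                ∎)
      where
      open ℕ.≤-Reasoning
      T = far v S
      T-dep : DependsOn (λ e → I v e ≡ 0) (clear T)
      T-dep = clear-depends {P = λ e → I v e ≡ 0} T λ u u∈T χ χ′ agree → local u χ χ′ λ e Iue≢0 →
        agree e (near≡0⇒disjoint v u (∈far⇒near≡0 v S u u∈T) e Iue≢0)
      swap : ∀ a b c → a * (b * c) ≡ b * (a * c)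
      swap = solve-∀

    union-rare : ∀ S T (c : Fin n → ℕ) → (∀ u → u ∈ S → c u ≡ 0 → u ∈ T) → Rare T →
      K * 𝔼 (clear T) ≤ K * 𝔼 (clear S) + sum c * (2 * 𝔼 (clear T))
    union-rare S T c S∖c⊆T rareT = begin
      K * 𝔼 (clear T)                                         ≤⟨ ℕ.*-monoʳ-≤ K (union-bound S T c S∖c⊆T) ⟩
      K * (𝔼 (clear S) + sum (λ u → c u * B u))               ≡⟨ ℕ.*-distribˡ-+ K (𝔼 (clear S)) (sum (λ u → c u * B u)) ⟩
      K * 𝔼 (clear S) + K * sum (λ u → c u * B u)             ≡⟨ cong (λ x → K * 𝔼 (clear S) + x) (*-distribˡ-sum K (λ u → c u * B u)) ⟩
      K * 𝔼 (clear S) + sum (λ u → K * (c u * B u))           ≡⟨ cong (λ x → K * 𝔼 (clear S) + x) (sum-cong-≗ (λ u → swap K (c u) (B u))) ⟩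
      K * 𝔼 (clear S) + sum (λ u → c u * (K * B u))           ≤⟨ ℕ.+-monoʳ-≤ (K * 𝔼 (clear S)) (sum-mono (λ u → ℕ.*-monoʳ-≤ (c u) (rareT u))) ⟩
      K * 𝔼 (clear S) + sum (λ u → c u * (2 * 𝔼 (clear T)))   ≡⟨ cong (λ x → K * 𝔼 (clear S) + x) (sym (*-distribʳ-sum (2 * 𝔼 (clear T)) c)) ⟩
      K * 𝔼 (clear S) + sum c * (2 * 𝔼 (clear T))             ∎
      where
      open ℕ.≤-Reasoning
      B : Fin n → ℕ
      B u = 𝔼 (λ χ → ⟦ bad u χ ⟧ * clear T χ)
      swap : ∀ a b c → a * (b * c) ≡ b * (a * c)
      swap = solve-∀

    -- Restoring the events near `v` costs at most the fraction `Δ * (2 / K)` of the mass, which is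
    -- at most one half by `4Δ≤K`.
    far-half : ∀ v S → Rare (far v S) → 𝔼 (clear (far v S)) ≤ 2 * 𝔼 (clear S)
    far-half v S rareT = ℕ.*-cancelˡ-≤ K (ℕ.+-cancelʳ-≤ (K * G) (K * G) (K * (2 * 𝔼 (clear S))) (begin
      K * G + K * G                                       ≡⟨ double (K * G) ⟩
      2 * (K * G)                                         ≤⟨ ℕ.*-monoʳ-≤ 2 (union-rare S (far v S) (near v) (∈far⁺ v S) rareT) ⟩
      2 * (K * 𝔼 (clear S) + sum (near v) * (2 * G))      ≤⟨ ℕ.*-monoʳ-≤ 2 (ℕ.+-monoʳ-≤ (K * 𝔼 (clear S)) (ℕ.*-monoˡ-≤ (2 * G) (sparse v))) ⟩
      2 * (K * 𝔼 (clear S) + Δ * (2 * G))                 ≡⟨ rearrange K (𝔼 (clear S)) Δ G ⟩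
      K * (2 * 𝔼 (clear S)) + 4 * Δ * G                   ≤⟨ ℕ.+-monoʳ-≤ (K * (2 * 𝔼 (clear S))) (ℕ.*-monoˡ-≤ G 4Δ≤K) ⟩
      K * (2 * 𝔼 (clear S)) + K * G                       ∎))
      where
      open ℕ.≤-Reasoning
      G = 𝔼 (clear (far v S))
      double : ∀ a → a + a ≡ 2 * a
      double = solve-∀
      rearrange : ∀ K E Δ G → 2 * (K * E + Δ * (2 * G)) ≡ K * (2 * E) + 4 * Δ * G
      rearrange = solve-∀

    -- The induction of the local lemma: the numerator is bounded by forgetting the events near `v`,
    -- which gives `1 / K`, and `far-half` restores them in the denominator at the price of the
    -- factor 2.
    rare-given-clear : ∀ S → Rare S
    rare-given-clear S = go S (⊂-wellFounded S)
      where
      go : ∀ S → Acc _⊂_ S → Rare S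
      go S (acc smaller) v = begin
        K * 𝔼 (λ χ → ⟦ bad v χ ⟧ * clear S χ)      ≤⟨ ℕ.*-monoʳ-≤ K (𝔼-mono (λ χ → ℕ.*-monoʳ-≤ ⟦ bad v χ ⟧ (clear-anti (far⊆ v S) χ))) ⟩
        K * 𝔼 (λ χ → ⟦ bad v χ ⟧ * clear T χ)      ≤⟨ far-rare v S ⟩
        𝔼 (clear T)                                ≤⟨ half ⟩
        2 * 𝔼 (clear S)                            ∎
        where
        open ℕ.≤-Reasoning
        T = far v S
        half : 𝔼 (clear T) ≤ 2 * 𝔼 (clear S)
        -- The induction needs `far v S` to be strictly smaller than `S`; if nothing in `S` is near
        -- `v`, the two coincide and no mass is lost.
        half with Fin.any? (λ u → (u ∈? S) ×-dec ¬? (near v u ℕ.≟ 0))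
        ... | yes (u , u∈S , near≢0) = far-half v S (go T (smaller (far⊆ v S , u , u∈S , near≢0 ∘ ∈far⇒near≡0 v S u)))
        ... | no all-far = ℕ.≤-trans (𝔼-mono (clear-anti S⊆T)) (ℕ.m≤m+n (𝔼 (clear S)) _)
          where
          S⊆T : S ⊆ˢ T
          S⊆T {u} u∈S with near v u ℕ.≟ 0
          ... | yes near≡0 = ∈far⁺ v S u u∈S near≡0
          ... | no near≢0 = contradiction (u , u∈S , near≢0) all-far

    -- Each further event removes at most the fraction `2 / K < 1` of the mass still present,
    -- starting from `q ^ m` for the empty set.
    clear-positive : 2 < K → ∀ S → 0 < 𝔼 (clear S)
    clear-positive 2<K S = go S (⊂-wellFounded S)
      where
      go : ∀ S → Acc _⊂_ S → 0 < 𝔼 (clear S)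
      go S (acc smaller) with nonempty? S
      ... | no empty = ℕ.<-≤-trans (ℕ.m^n>0 q m) (subst (_≤ 𝔼 (clear S)) (𝔼-1 m)
        (𝔼-mono λ χ → ⟦does⟧-mono (yes refl) (clear? S χ) (λ (_ : 0 ≡ 0) u u∈S → contradiction (u , u∈S) empty)))
      ... | yes (v , v∈S) = ℕ.n≢0⇒n>0 λ 𝔼S≡0 → ℕ.<⇒≱ (ℕ.*-monoˡ-< G ⦃ >-nonZero 0<G ⦄ 2<K) (begin
        K * G                                          ≤⟨ union-rare S T (λ u → ⟦ does (u Fin.≟ v) ⟧) S∖v⊆T (rare-given-clear T) ⟩
        K * 𝔼 (clear S) + sum (λ u → ⟦ does (u Fin.≟ v) ⟧) * (2 * G)  ≡⟨ cong₂ (λ s t → K * s + t * (2 * G)) 𝔼S≡0 (sum-point v) ⟩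
        K * 0 + 1 * (2 * G)                            ≡⟨ cong₂ _+_ (ℕ.*-zeroʳ K) (ℕ.*-identityˡ (2 * G)) ⟩
        2 * G                                          ∎)
        where
        open ℕ.≤-Reasoning
        T = S - v
        G = 𝔼 (clear T)
        0<G : 0 < G
        0<G = go T (smaller (x∈p⇒p-x⊂p v∈S))
        S∖v⊆T : ∀ u → u ∈ S → ⟦ does (u Fin.≟ v) ⟧ ≡ 0 → u ∈ T
        S∖v⊆T u u∈S eq with u Fin.≟ v
        ... | no u≢v = x∈p∧x≢y⇒x∈p-y u∈S u≢v

    local-lemma : 2 < K → ∃[ χ ] (∀ v → ⟦ bad v χ ⟧ ≡ 0)
    local-lemma 2<K with 𝔼-witness (clear ⊤) (clear-positive 2<K ⊤)
    ... | χ , 0<clear with clear? ⊤ χ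
    ... | yes ok = χ , λ v → ok v ∈⊤

-- Elementary estimates for powers of `1 - 1 / q` and `1 + 1 / q`

^-*-distrib : ∀ a b k → (a * b) ^ k ≡ a ^ k * b ^ k
^-*-distrib a b zero    = refl
^-*-distrib a b (suc k) = trans (cong (a * b *_) (^-*-distrib a b k)) (rearrange a b (a ^ k) (b ^ k))
  where
  rearrange : ∀ a b c d → a * b * (c * d) ≡ a * c * (b * d)
  rearrange = solve-∀

-- This is `1 + k / p ≤ (1 + 1 / p) ^ k` with denominators cleared.
bernoulli : ∀ p k → p ^ k * (p + k) ≤ p * suc p ^ k
bernoulli p zero    = ℕ.≤-reflexive (base p)
  where
  base : ∀ p → 1 * (p + 0) ≡ p * 1
  base = solve-∀
bernoulli p (suc k) = begin
  p * p ^ k * (p + suc k)              ≡⟨ expand p (p ^ k) k ⟩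
  p ^ k * (p * (p + k) + p)            ≤⟨ ℕ.*-monoʳ-≤ (p ^ k) (ℕ.+-monoʳ-≤ (p * (p + k)) (ℕ.m≤m+n p k)) ⟩
  p ^ k * (p * (p + k) + (p + k))      ≡⟨ collect p (p ^ k) k ⟩
  suc p * (p ^ k * (p + k))            ≤⟨ ℕ.*-monoʳ-≤ (suc p) (bernoulli p k) ⟩
  suc p * (p * suc p ^ k)              ≡⟨ swap (suc p) p (suc p ^ k) ⟩
  p * (suc p * suc p ^ k)              ∎
  where
  open ℕ.≤-Reasoning
  expand : ∀ p P k → p * P * (p + suc k) ≡ P * (p * (p + k) + p)
  expand = solve-∀
  collect : ∀ p P k → P * (p * (p + k) + (p + k)) ≡ suc p * (P * (p + k))
  collect = solve-∀
  swap : ∀ a b c → a * (b * c) ≡ b * (a * c)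
  swap = solve-∀

2*p^q≤q^q : ∀ p → 2 * p ^ suc p ≤ suc p ^ suc p
2*p^q≤q^q zero = z≤n
2*p^q≤q^q p@(suc _) = ℕ.*-cancelˡ-≤ p (begin
  p * (2 * p ^ suc p)         ≡⟨ rearrange p (p ^ suc p) ⟩
  p ^ suc p * (p + p)         ≤⟨ ℕ.*-monoʳ-≤ (p ^ suc p) (ℕ.+-monoʳ-≤ p (ℕ.n≤1+n p)) ⟩
  p ^ suc p * (p + suc p)     ≤⟨ bernoulli p (suc p) ⟩
  p * suc p ^ suc p           ∎)
  where
  open ℕ.≤-Reasoning
  rearrange : ∀ p P → p * (2 * P) ≡ P * (p + p)
  rearrange = solve-∀

-- With `q = suc p`, the chance `(1 - 1 / q) ^ D` that none of `D` edges is kept is halved by each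
-- block of `q` edges.
2^k*p^D≤q^D : ∀ p k D → k * suc p ≤ D → 2 ^ k * p ^ D ≤ suc p ^ D
2^k*p^D≤q^D p k D kq≤D = begin
  2 ^ k * p ^ D                            ≡⟨ cong (2 ^ k *_) (split p) ⟩
  2 ^ k * ((p ^ q) ^ k * p ^ s)            ≡⟨ sym (ℕ.*-assoc (2 ^ k) ((p ^ q) ^ k) (p ^ s)) ⟩
  2 ^ k * (p ^ q) ^ k * p ^ s              ≡⟨ cong (_* p ^ s) (sym (^-*-distrib 2 (p ^ q) k)) ⟩
  (2 * p ^ q) ^ k * p ^ s                  ≤⟨ ℕ.*-mono-≤ (ℕ.^-monoˡ-≤ k (2*p^q≤q^q p)) (ℕ.^-monoˡ-≤ s (ℕ.n≤1+n p)) ⟩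
  (q ^ q) ^ k * q ^ s                      ≡⟨ sym (split q) ⟩
  q ^ D                                    ∎
  where
  open ℕ.≤-Reasoning
  q = suc p
  s = D ∸ k * q
  split : ∀ x → x ^ D ≡ (x ^ q) ^ k * x ^ s
  split x = trans (cong (x ^_) (trans (sym (ℕ.m+[n∸m]≡n kq≤D)) (cong (_+ s) (ℕ.*-comm k q))))
    (trans (ℕ.^-distribˡ-+-* x (q * k) s) (cong (_* x ^ s) (sym (ℕ.^-*-assoc x q k))))

-- The companion inequality `1 - k / (q + 1) ≤ (1 - 1 / (q + 1)) ^ k`, free of subtraction.
power-growth : ∀ q k → suc q * suc q ^ k ≤ suc q * q ^ k + k * suc q ^ k
power-growth q zero    = ℕ.m≤m+n (suc q * 1) 0
power-growth q (suc k) = begin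
  suc q * (suc q * suc q ^ k)                                   ≤⟨ ℕ.*-monoʳ-≤ (suc q) (power-growth q k) ⟩
  suc q * (suc q * q ^ k + k * suc q ^ k)                       ≡⟨ expand q k (q ^ k) (suc q ^ k) ⟩
  suc q * (q * q ^ k) + (suc q * q ^ k + k * (suc q * suc q ^ k))
    ≤⟨ ℕ.+-monoʳ-≤ (suc q * (q * q ^ k)) (ℕ.+-monoˡ-≤ (k * (suc q * suc q ^ k)) (ℕ.*-monoʳ-≤ (suc q) (ℕ.^-monoˡ-≤ k (ℕ.n≤1+n q)))) ⟩
  suc q * (q * q ^ k) + suc k * (suc q * suc q ^ k)             ∎
  where
  open ℕ.≤-Reasoning
  expand : ∀ q k P Q → suc q * (suc q * P + k * Q) ≡ suc q * (q * P) + (suc q * P + k * (suc q * Q))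
  expand = solve-∀

[q+1]^k≤2*q^k : ∀ q k → 2 * k ≤ suc q → suc q ^ k ≤ 2 * q ^ k
[q+1]^k≤2*q^k q k 2k≤q+1 = ℕ.*-cancelˡ-≤ (suc q) (ℕ.+-cancelʳ-≤ (suc q * suc q ^ k) (suc q * suc q ^ k) (suc q * (2 * q ^ k)) (begin
  suc q * suc q ^ k + suc q * suc q ^ k              ≡⟨ double (suc q * suc q ^ k) ⟩
  2 * (suc q * suc q ^ k)                            ≤⟨ ℕ.*-monoʳ-≤ 2 (power-growth q k) ⟩
  2 * (suc q * q ^ k + k * suc q ^ k)                ≡⟨ rearrange (suc q) k (q ^ k) (suc q ^ k) ⟩
  suc q * (2 * q ^ k) + 2 * k * suc q ^ k            ≤⟨ ℕ.+-monoʳ-≤ (suc q * (2 * q ^ k)) (ℕ.*-monoˡ-≤ (suc q ^ k) 2k≤q+1) ⟩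
  suc q * (2 * q ^ k) + suc q * suc q ^ k            ∎))
  where
  open ℕ.≤-Reasoning
  double : ∀ a → a + a ≡ 2 * a
  double = solve-∀
  rearrange : ∀ s k P Q → 2 * (s * P + k * Q) ≡ s * (2 * P) + 2 * k * Q
  rearrange = solve-∀

half-above : ∀ q → ∃[ k ] q ≤ 2 * k × 2 * k ≤ suc q
half-above zero          = 0 , z≤n , z≤n
half-above (suc zero)    = 1 , s≤s z≤n , ℕ.≤-refl
half-above (suc (suc q)) with half-above q
... | k , q≤2k , 2k≤q+1 = suc k , subst (suc (suc q) ≤_) (sym (ℕ.*-suc 2 k)) (s≤s (s≤s q≤2k))
                                , subst (_≤ suc (suc (suc q))) (sym (ℕ.*-suc 2 k)) (s≤s (s≤s 2k≤q+1))

-- The factor `(1 + 1 / q) ^ D` is the mean of `2 ^ X` for `D` edges. A block of `k = ⌈q / 2⌉` edges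
-- at most doubles it, and `2 * j` blocks cover `D`; the exponent is padded by `s` to fill the last
-- ones.
[q+1]^D≤4^j*q^D : ∀ p j D → D ≤ j * suc p → suc (suc p) ^ D ≤ 2 ^ (2 * j) * suc p ^ D
[q+1]^D≤4^j*q^D p j D D≤jq with half-above (suc p)
... | k , q≤2k , 2k≤q+1 = ℕ.*-cancelʳ-≤ (suc q ^ D) (2 ^ i * q ^ D) (q ^ s) ⦃ ℕ.m^n≢0 q s ⦄ (begin
  suc q ^ D * q ^ s                ≤⟨ ℕ.*-monoʳ-≤ (suc q ^ D) (ℕ.^-monoˡ-≤ s (ℕ.n≤1+n q)) ⟩
  suc q ^ D * suc q ^ s            ≡⟨ join (suc q) ⟩
  (suc q ^ k) ^ i                  ≤⟨ ℕ.^-monoˡ-≤ i ([q+1]^k≤2*q^k q k 2k≤q+1) ⟩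
  (2 * q ^ k) ^ i                  ≡⟨ ^-*-distrib 2 (q ^ k) i ⟩
  2 ^ i * (q ^ k) ^ i              ≡⟨ cong (2 ^ i *_) (sym (join q)) ⟩
  2 ^ i * (q ^ D * q ^ s)          ≡⟨ sym (ℕ.*-assoc (2 ^ i) (q ^ D) (q ^ s)) ⟩
  2 ^ i * q ^ D * q ^ s            ∎)
  where
  open ℕ.≤-Reasoning
  q = suc p
  i = 2 * j
  D≤ki : D ≤ k * i
  D≤ki = ℕ.≤-trans D≤jq (ℕ.≤-trans (ℕ.*-monoʳ-≤ j q≤2k) (ℕ.≤-reflexive (rearrange j k)))
    where
    rearrange : ∀ j k → j * (2 * k) ≡ k * (2 * j)
    rearrange = solve-∀
  s = k * i ∸ D
  join : ∀ x → x ^ D * x ^ s ≡ (x ^ k) ^ i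
  join x = trans (sym (ℕ.^-distribˡ-+-* x D s)) (trans (cong (x ^_) (ℕ.m+[n∸m]≡n D≤ki)) (sym (ℕ.^-*-assoc x k i)))

n<2^n : ∀ n → n < 2 ^ n
n<2^n zero    = s≤s z≤n
n<2^n (suc n) = ℕ.+-mono-≤ (ℕ.m^n>0 2 n) (subst (suc n ≤_) (sym (ℕ.+-identityʳ (2 ^ n))) (n<2^n n))

-- Random sampling of edges

module Extreme (t : ℕ) where

  extreme : ℕ → Bool
  extreme x = does (x ℕ.≟ 0) ∨ does (t ℕ.<? x)

  tail-moment : ∀ {x} (t<x? : Dec (t < x)) → 2 ^ t * ⟦ does t<x? ⟧ ≤ 2 ^ x
  tail-moment (no _)    = ℕ.≤-trans (ℕ.≤-reflexive (ℕ.*-zeroʳ (2 ^ t))) z≤n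
  tail-moment (yes t<x) = ℕ.≤-trans (ℕ.≤-reflexive (ℕ.*-identityʳ (2 ^ t))) (ℕ.^-monoʳ-≤ 2 (ℕ.<⇒≤ t<x))

  -- Markov's inequality for both ends at once: `0 ^ x` is the indicator of `x ≡ 0`, since `0 ^ 0`
  -- is 1, and `2 ^ x` exceeds `2 ^ t` beyond `t`.
  extreme-moments : ∀ x → 2 ^ t * ⟦ extreme x ⟧ ≤ 2 ^ t * 0 ^ x + 2 ^ x
  extreme-moments zero    = ℕ.m≤m+n (2 ^ t * 1) 1
  extreme-moments (suc x) = ℕ.≤-trans (tail-moment (t ℕ.<? suc x)) (ℕ.m≤n+m (2 ^ suc x) (2 ^ t * 0))

  not-tail : ∀ {x} (t<x? : Dec (t < x)) → ⟦ does t<x? ⟧ ≡ 0 → x ≤ t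
  not-tail (no t≮x) _ = ℕ.≮⇒≥ t≮x

  ¬extreme⇒bounds : ∀ x → ⟦ extreme x ⟧ ≡ 0 → 1 ≤ x × x ≤ t
  ¬extreme⇒bounds (suc x) eq = s≤s z≤n , not-tail (t ℕ.<? suc x) eq

module Sampling {m n} (b : Fin n → Fin m → Bool) (p ℓ : ℕ) .⦃ _ : NonZero ℓ ⦄ (r : ℕ) where

  open Weighted p

  -- `K` is `2 ^ (12 ℓ - 1)`, half of `2 ^ (12 ℓ)` because there are two tails; `k` avoids a
  -- subtraction in the exponent.
  t k K : ℕ
  t = 50 * ℓ
  k = pred ℓ
  K = 2 ^ (11 + 12 * k)

  ℓ≡1+k : ℓ ≡ suc k
  ℓ≡1+k = sym (ℕ.suc-pred ℓ)

  I : Fin n → Fin m → ℕ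
  I v = ⟦_⟧ ∘ b v

  X : Fin n → Vec Bool m → ℕ
  X v χ = row-sum (I v) (⟦_⟧ ∘ lookup χ)

  bad : Fin n → Vec Bool m → Bool
  bad v χ = Extreme.extreme t (X v χ)

  bad-local : ∀ v → DependsOn (λ e → I v e ≢ 0) (λ χ → ⟦ bad v χ ⟧)
  bad-local v χ χ′ agree = cong (λ x → ⟦ Extreme.extreme t x ⟧) (sum-cong-≗ (λ e → term e (b v e) refl))
    where
    term : ∀ e c → b v e ≡ c → I v e * ⟦ lookup χ e ⟧ ≡ I v e * ⟦ lookup χ′ e ⟧
    term e true  eq = cong (λ c → I v e * ⟦ c ⟧) (agree e (λ I≡0 → contradiction (trans (sym (cong ⟦_⟧ eq)) I≡0) λ ()))
    term e false eq = trans (cong (λ c → ⟦ c ⟧ * ⟦ lookup χ e ⟧) eq) (sym (cong (λ c → ⟦ c ⟧ * ⟦ lookup χ′ e ⟧) eq))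

  2K≡2^12ℓ : 2 * K ≡ 2 ^ (12 * ℓ)
  2K≡2^12ℓ = cong (2 ^_) (trans (eq k) (cong (12 *_) (sym ℓ≡1+k)))
    where
    eq : ∀ k → 12 + 12 * k ≡ 12 * suc k
    eq = solve-∀

  module _ (lower : ∀ v → 12 * ℓ * q ≤ sum (I v)) (upper : ∀ v → sum (I v) ≤ 16 * ℓ * q) where

    -- Once `2 ^ t` and `q ^ D` are cleared, each of the two moments contributes at most one copy of
    -- `2 ^ t * q ^ D * q ^ m`: `lower` controls the empty degrees, `upper` the large ones.
    rare : ∀ v → K * 𝔼 (λ χ → ⟦ bad v χ ⟧) ≤ q ^ m
    rare v = ℕ.*-cancelˡ-≤ (2 * (2 ^ t * q ^ D)) ⦃ ℕ.m*n≢0 2 (2 ^ t * q ^ D) ⦃ _ ⦄ ⦃ ℕ.m*n≢0 (2 ^ t) (q ^ D) ⦃ ℕ.m^n≢0 2 t ⦄ ⦃ ℕ.m^n≢0 q D ⦄ ⦄ ⦄ (begin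
      2 * (2 ^ t * q ^ D) * (K * P)                  ≡⟨ rearrange₁ (2 ^ t) (q ^ D) K P ⟩
      2 * K * (2 ^ t * P * q ^ D)                    ≡⟨ cong₂ (λ a b → a * (b * q ^ D)) 2K≡2^12ℓ (sym (𝔼-* (2 ^ t) (λ χ → ⟦ bad v χ ⟧))) ⟩
      M * (𝔼 (λ χ → 2 ^ t * ⟦ bad v χ ⟧) * q ^ D)    ≤⟨ ℕ.*-monoʳ-≤ M (ℕ.*-monoˡ-≤ (q ^ D) (𝔼-mono (λ χ → Extreme.extreme-moments t (X v χ)))) ⟩
      M * (𝔼 (λ χ → 2 ^ t * 0 ^ X v χ + 2 ^ X v χ) * q ^ D)
        ≡⟨ cong (λ a → M * (a * q ^ D)) (trans (𝔼-+ (λ χ → 2 ^ t * 0 ^ X v χ) (λ χ → 2 ^ X v χ)) (cong (_+ 𝔼 (λ χ → 2 ^ X v χ)) (𝔼-* (2 ^ t) (λ χ → 0 ^ X v χ)))) ⟩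
      M * ((2 ^ t * 𝔼 (λ χ → 0 ^ X v χ) + 𝔼 (λ χ → 2 ^ X v χ)) * q ^ D)
        ≡⟨ rearrange₂ M (2 ^ t) (𝔼 (λ χ → 0 ^ X v χ)) (𝔼 (λ χ → 2 ^ X v χ)) (q ^ D) ⟩
      2 ^ t * (M * (𝔼 (λ χ → 0 ^ X v χ) * q ^ D)) + M * (𝔼 (λ χ → 2 ^ X v χ) * q ^ D)
        ≡⟨ cong₂ (λ a b → 2 ^ t * (M * a) + M * b) (𝔼-moment (b v) 0) (𝔼-moment (b v) 2) ⟩
      2 ^ t * (M * (p ^ D * q ^ m)) + M * (suc q ^ D * q ^ m)
        ≡⟨ rearrange₃ (2 ^ t) M (p ^ D) (q ^ m) (suc q ^ D) ⟩
      2 ^ t * (M * p ^ D) * q ^ m + M * suc q ^ D * q ^ m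
        ≤⟨ ℕ.+-mono-≤ (ℕ.*-monoˡ-≤ (q ^ m) (ℕ.*-monoʳ-≤ (2 ^ t) (2^k*p^D≤q^D p (12 * ℓ) D (lower v)))) (ℕ.*-monoˡ-≤ (q ^ m) large) ⟩
      2 ^ t * q ^ D * q ^ m + 2 ^ t * q ^ D * q ^ m  ≡⟨ rearrange₄ (2 ^ t * q ^ D) (q ^ m) ⟩
      2 * (2 ^ t * q ^ D) * q ^ m                    ∎)
      where
      open ℕ.≤-Reasoning
      D = sum (I v)
      M = 2 ^ (12 * ℓ)
      P = 𝔼 (λ χ → ⟦ bad v χ ⟧)
      rearrange₁ : ∀ T Q K P → 2 * (T * Q) * (K * P) ≡ 2 * K * (T * P * Q)
      rearrange₁ = solve-∀
      rearrange₂ : ∀ M T A B Q → M * ((T * A + B) * Q) ≡ T * (M * (A * Q)) + M * (B * Q)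
      rearrange₂ = solve-∀
      rearrange₃ : ∀ T M A Q B → T * (M * (A * Q)) + M * (B * Q) ≡ T * (M * A) * Q + M * B * Q
      rearrange₃ = solve-∀
      rearrange₄ : ∀ a b → a * b + a * b ≡ 2 * a * b
      rearrange₄ = solve-∀
      -- The mean of `2 ^ X` is at most `2 ^ (32 ℓ)`, and a gain of `2 ^ (12 ℓ)` is wanted, so
      -- `50 ℓ` leaves `6 ℓ` to spare.
      exponents : ∀ ℓ → 12 * ℓ + 2 * (16 * ℓ) + 6 * ℓ ≡ 50 * ℓ
      exponents = solve-∀
      large : M * suc q ^ D ≤ 2 ^ t * q ^ D
      large = begin
        M * suc q ^ D                                ≤⟨ ℕ.*-monoʳ-≤ M ([q+1]^D≤4^j*q^D p (16 * ℓ) D (upper v)) ⟩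
        M * (2 ^ (2 * (16 * ℓ)) * q ^ D)             ≡⟨ sym (ℕ.*-assoc M (2 ^ (2 * (16 * ℓ))) (q ^ D)) ⟩
        M * 2 ^ (2 * (16 * ℓ)) * q ^ D               ≡⟨ cong (_* q ^ D) (sym (ℕ.^-distribˡ-+-* 2 (12 * ℓ) (2 * (16 * ℓ)))) ⟩
        2 ^ (12 * ℓ + 2 * (16 * ℓ)) * q ^ D          ≤⟨ ℕ.*-monoˡ-≤ (q ^ D) (ℕ.^-monoʳ-≤ 2 (ℕ.≤-trans (ℕ.m≤m+n (12 * ℓ + 2 * (16 * ℓ)) (6 * ℓ)) (ℕ.≤-reflexive (exponents ℓ)))) ⟩
        2 ^ t * q ^ D                                ∎

    sparse : (∀ e → sum (λ v → I v e) ≤ r) → ∀ v → sum (λ u → row-sum (I v) (I u)) ≤ 16 * ℓ * q * r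
    sparse col≤r v = begin
      sum (λ u → sum (λ e → I v e * I u e))      ≡⟨ ∑-comm (λ u e → I v e * I u e) ⟩
      sum (λ e → sum (λ u → I v e * I u e))      ≡⟨ sum-cong-≗ (λ e → sym (*-distribˡ-sum (I v e) (λ u → I u e))) ⟩
      sum (λ e → I v e * sum (λ u → I u e))      ≤⟨ sum-mono (λ e → ℕ.*-monoʳ-≤ (I v e) (col≤r e)) ⟩
      sum (λ e → I v e * r)                      ≡⟨ sym (*-distribʳ-sum r (I v)) ⟩
      sum (I v) * r                              ≤⟨ ℕ.*-monoˡ-≤ r (upper v) ⟩
      16 * ℓ * q * r                             ∎
      where open ℕ.≤-Reasoning

    -- With `ℓ ≤ 2 ^ k`, `r ≤ 4 * 2 ^ k` and `q ≤ 8 * 2 ^ k` the left side is at most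
    -- `2 ^ (11 + 3 k)`. At `ℓ = 1` this bound equals `K`, which is what the 12 in the window is
    -- for.
    4Δ≤K : q ≤ 2 * r → r ≤ 2 ^ suc ℓ → 4 * (16 * ℓ * q * r) ≤ K
    4Δ≤K q≤2r r≤2^ℓ+1 = begin
      4 * (16 * ℓ * q * r)                       ≡⟨ rearrange₁ ℓ q r ⟩
      64 * ℓ * (q * r)                           ≤⟨ ℕ.*-mono-≤ (ℕ.*-monoʳ-≤ 64 (subst (_≤ 2 ^ k) (sym ℓ≡1+k) (n<2^n k))) (ℕ.*-mono-≤ (ℕ.≤-trans q≤2r (ℕ.*-monoʳ-≤ 2 r≤2^ℓ+1)) r≤2^ℓ+1) ⟩
      64 * 2 ^ k * (2 * 2 ^ suc ℓ * 2 ^ suc ℓ)   ≡⟨ cong (λ a → 64 * 2 ^ k * (2 * (2 * a) * (2 * a))) (cong (2 ^_) ℓ≡1+k) ⟩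
      64 * 2 ^ k * (2 * (2 * (2 * 2 ^ k)) * (2 * (2 * 2 ^ k)))  ≡⟨ rearrange₂ (2 ^ k) ⟩
      2 ^ 11 * (2 ^ k * (2 ^ k * 2 ^ k))         ≡⟨ cong (λ a → 2 ^ 11 * (2 ^ k * a)) (sym (ℕ.^-distribˡ-+-* 2 k k)) ⟩
      2 ^ 11 * (2 ^ k * 2 ^ (k + k))             ≡⟨ cong (2 ^ 11 *_) (sym (ℕ.^-distribˡ-+-* 2 k (k + k))) ⟩
      2 ^ 11 * 2 ^ (k + (k + k))                 ≡⟨ sym (ℕ.^-distribˡ-+-* 2 11 (k + (k + k))) ⟩
      2 ^ (11 + (k + (k + k)))                   ≤⟨ ℕ.^-monoʳ-≤ 2 (ℕ.+-monoʳ-≤ 11 (ℕ.≤-trans (ℕ.m≤m+n (k + (k + k)) (9 * k)) (ℕ.≤-reflexive (exponents k)))) ⟩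
      K                                          ∎
      where
      open ℕ.≤-Reasoning
      rearrange₁ : ∀ ℓ q r → 4 * (16 * ℓ * q * r) ≡ 64 * ℓ * (q * r)
      rearrange₁ = solve-∀
      rearrange₂ : ∀ a → 64 * a * (2 * (2 * (2 * a)) * (2 * (2 * a))) ≡ 2 ^ 11 * (a * (a * a))
      rearrange₂ = solve-∀
      exponents : ∀ k → k + (k + k) + 9 * k ≡ 12 * k
      exponents = solve-∀

    abstract
      sampling : (∀ e → sum (λ v → I v e) ≤ r) → q ≤ 2 * r → r ≤ 2 ^ suc ℓ →
        ∃[ χ ] (∀ v → 1 ≤ X v χ × X v χ ≤ t)
      sampling col≤r q≤2r r≤2^ℓ+1 = map₂ (λ {χ} ok v → Extreme.¬extreme⇒bounds t (X v χ) (ok v))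
        (LocalLemma.local-lemma p I bad bad-local K (16 * ℓ * q * r) (ℕ.m^n>0 2 (11 + 12 * k))
          (4Δ≤K q≤2r r≤2^ℓ+1) rare (sparse col≤r) (ℕ.≤-trans 3≤2^11 (ℕ.^-monoʳ-≤ 2 (ℕ.m≤m+n 11 (12 * k)))))
        where
        3≤2^11 : 3 ≤ 2 ^ 11
        3≤2^11 = s≤s (s≤s (s≤s z≤n))

-- Hypergraphs

select : ∀ {A : Set} (xs : List A) → (Fin (length xs) → Bool) → List A
select []       χ = []
select (x ∷ xs) χ = if χ zero then x ∷ select xs (χ ∘ suc) else select xs (χ ∘ suc)

select-sublist : ∀ {A : Set} (xs : List A) χ → select xs χ Sublist.⊆ xs
select-sublist []       χ = []
select-sublist (x ∷ xs) χ with χ zero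
... | true  = refl ∷ select-sublist xs (χ ∘ suc)
... | false = x ∷ʳ select-sublist xs (χ ∘ suc)

select-unique : ∀ {A : Set} (xs : List A) χ → Unique xs → Unique (select xs χ)
select-unique []       χ []             = []
select-unique (x ∷ xs) χ (x∉xs ∷ uniq) with χ zero
... | true  = All-resp-⊆ (select-sublist xs (χ ∘ suc)) x∉xs ∷ select-unique xs (χ ∘ suc) uniq
... | false = select-unique xs (χ ∘ suc) uniq

incidence : ∀ {n} (es : List (Subset n)) → Fin n → Fin (length es) → Bool
incidence es v i = does (v ∈? List.lookup es i)

length-filter-select : ∀ {n} (es : List (Subset n)) χ v →
  length (filter (v ∈?_) (select es χ)) ≡ row-sum (⟦_⟧ ∘ incidence es v) (⟦_⟧ ∘ χ)
length-filter-select []       χ v = refl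
length-filter-select (e ∷ es) χ v with χ zero
... | false = trans (length-filter-select es (χ ∘ suc) v)
  (cong (_+ row-sum (⟦_⟧ ∘ incidence es v) (⟦_⟧ ∘ χ ∘ suc)) (sym (ℕ.*-zeroʳ ⟦ does (v ∈? e) ⟧)))
... | true with does (v ∈? e)
...   | true  = cong suc (length-filter-select es (χ ∘ suc) v)
...   | false = length-filter-select es (χ ∘ suc) v

length-filter : ∀ {n} (es : List (Subset n)) v →
  length (filter (v ∈?_) es) ≡ sum (⟦_⟧ ∘ incidence es v)
length-filter []       v = refl
length-filter (e ∷ es) v with does (v ∈? e)
... | true  = cong suc (length-filter es v)
... | false = length-filter es v

sum-∈ : ∀ {n} (e : Subset n) → sum (λ v → ⟦ does (v ∈? e) ⟧) ≡ ∣ e ∣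
sum-∈ []          = refl
sum-∈ (true ∷ e)  = cong suc (sum-∈ e)
sum-∈ (false ∷ e) = sum-∈ e

module _ {n : ℕ} (H : Hypergraph n) where

  restrict : (Fin (length (edges H)) → Bool) → Hypergraph n
  restrict χ .edges  = select (edges H) χ
  restrict χ .unique = select-unique (edges H) χ (unique H)

  restrict-⊆ : ∀ χ → restrict χ ⊆ H
  restrict-⊆ χ = Sublist.lookup (select-sublist (edges H) χ)

  restrict-uniform : ∀ {r} χ → Uniform r H → Uniform r (restrict χ)
  restrict-uniform χ = All-resp-⊆ (select-sublist (edges H) χ)

  columns : ∀ {r} → Uniform r H → ∀ e → sum (λ v → ⟦ incidence (edges H) v e ⟧) ≤ r
  columns uni e = ℕ.≤-reflexive (trans (sum-∈ (List.lookup (edges H) e)) (All.lookup uni (∈-lookup e)))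

-- Regularity lets the constant weight `s / d` give every vertex the same fractional degree `s`.
thin : ∀ {n} (H : Hypergraph n) {r d} s → Uniform r H → (∀ v → deg H v ≡ d) → 0 < d → s ≤ d →
  ∃[ C ] (C ⊆ H × Uniform r C × (∀ v → deg C v ≤ s + r × s ≤ deg C v + r))
thin H {r} {d} s uni reg 0<d s≤d
  with rounding r (λ v → ⟦_⟧ ∘ incidence (edges H) v) (columns H uni) d (λ _ → s) (λ _ → s≤d)
... | χ , bounds = restrict H χ , restrict-⊆ H χ , restrict-uniform H χ uni , λ v →
      subst (_≤ s + r) (sym (length-filter-select (edges H) χ v)) (ℕ.*-cancelˡ-≤ d (subst (d * X v ≤_) (target v) (proj₁ (bounds v))))
    , subst (λ x → s ≤ x + r) (sym (length-filter-select (edges H) χ v)) (ℕ.*-cancelˡ-≤ d (subst₂ _≤_ (average v) (sym (ℕ.*-distribˡ-+ d (X v) r)) (proj₂ (bounds v))))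
  where
  instance
    d≢0 : NonZero d
    d≢0 = >-nonZero 0<d
  I : ∀ v → Fin (length (edges H)) → ℕ
  I v = ⟦_⟧ ∘ incidence (edges H) v
  X : ∀ v → ℕ
  X v = row-sum (I v) (⟦_⟧ ∘ χ)
  average : ∀ v → row-sum (I v) (λ _ → s) ≡ d * s
  average v = trans (sym (*-distribʳ-sum s (I v))) (cong (_* s) (trans (sym (length-filter (edges H) v)) (reg v)))
  target : ∀ v → row-sum (I v) (λ _ → s) + d * r ≡ d * (s + r)
  target v = trans (cong (_+ d * r) (average v)) (sym (ℕ.*-distribˡ-+ d s r))

sample : ∀ {n} (H : Hypergraph n) {r} ℓ .⦃ _ : NonZero ℓ ⦄ p → Uniform r H →
  (∀ v → 12 * ℓ * suc p ≤ deg H v × deg H v ≤ 16 * ℓ * suc p) →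
  suc p ≤ 2 * r → r ≤ 2 ^ suc ℓ →
  ∃[ C ] (C ⊆ H × (∀ v → 1 ≤ deg C v × deg C v ≤ 50 * ℓ))
sample H {r} ℓ p uni window q≤2r r≤2^ℓ+1
  with Sampling.sampling (incidence (edges H)) p ℓ r
    (λ v → subst (12 * ℓ * suc p ≤_) (length-filter (edges H) v) (proj₁ (window v)))
    (λ v → subst (_≤ 16 * ℓ * suc p) (length-filter (edges H) v) (proj₂ (window v)))
    (columns H uni) q≤2r r≤2^ℓ+1
... | χ , bounds = restrict H (Vec.lookup χ) , restrict-⊆ H (Vec.lookup χ) , λ v →
  subst (λ x → 1 ≤ x × x ≤ 50 * ℓ) (sym (length-filter-select (edges H) (Vec.lookup χ) v)) (bounds v)

-- The ranges of the degree

inhabited : ∀ {n} (e : Subset n) → 0 < ∣ e ∣ → Inhabited e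
inhabited {n} e 0<∣e∣ with nonempty? e
... | yes v∈e = v∈e
... | no empty = contradiction (subst (0 <_) (trans (cong ∣_∣ (Empty-unique empty)) (∣⊥∣≡0 n)) 0<∣e∣) λ ()

-- An edge has a vertex, and regularity passes its positive degree on to all. This serves the case
-- where `H` covers itself, and makes `d` a legitimate denominator in `thin`.
degree-positive : ∀ {n} (H : Hypergraph n) {r d} → Nonempty H → Uniform r H → 0 < r → (∀ v → deg H v ≡ d) → 0 < d
degree-positive H {d = d} nonempty uni 0<r reg with edges H | uni
... | []     | _ = contradiction refl nonempty
... | e ∷ es | ∣e∣≡r ∷ _ with inhabited e (subst (0 <_) (sym ∣e∣≡r) 0<r)
... | u , u∈e = subst (0 <_) (trans (cong length (sym (List.filter-accept (u ∈?_) {x = e} {xs = es} u∈e))) (reg u)) (s≤s z≤n)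

-- Take `q = ⌊d / (12 ℓ)⌋`. Rounding down loses a factor of at most `(q + 1) / q`, which is at most
-- `4 / 3` as `d > 50 ℓ` forces `q ≥ 3`; hence 16 against 12.
quotient-window : ∀ ℓ .⦃ _ : NonZero ℓ ⦄ d → 50 * ℓ < d → ∃[ p ] (12 * ℓ * suc p ≤ d × d ≤ 16 * ℓ * suc p)
quotient-window ℓ d 50ℓ<d = window (d / c) lower upper
  where
  open ℕ.≤-Reasoning
  c = 12 * ℓ
  instance c≢0 = ℕ.m*n≢0 12 ℓ
  lower : c * (d / c) ≤ d
  lower = subst (_≤ d) (ℕ.*-comm (d / c) c) (ℕ.m/n*n≤m d c)
  upper : d < c + c * (d / c)
  upper = subst₂ _<_ (sym (ℕ.m≡m%n+[m/n]*n d c)) (cong (λ x → c + x) (ℕ.*-comm (d / c) c)) (ℕ.+-monoˡ-< (d / c * c) (ℕ.m%n<n d c))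
  small : ∀ q → q ≤ 2 → ¬ d < c + c * q
  small q q≤2 d< = ℕ.<-asym 50ℓ<d (begin-strict
    d                                <⟨ d< ⟩
    c + c * q                        ≤⟨ ℕ.+-monoʳ-≤ c (ℕ.*-monoʳ-≤ c q≤2) ⟩
    c + c * 2                        ≤⟨ ℕ.m≤m+n (c + c * 2) (14 * ℓ) ⟩
    c + c * 2 + 14 * ℓ               ≡⟨ eq ℓ ⟩
    50 * ℓ                           ∎)
    where
    eq : ∀ ℓ → 12 * ℓ + 12 * ℓ * 2 + 14 * ℓ ≡ 50 * ℓ
    eq = solve-∀
  window : ∀ q → c * q ≤ d → d < c + c * q → ∃[ p ] (12 * ℓ * suc p ≤ d × d ≤ 16 * ℓ * suc p)
  window zero    _    d<c   = contradiction d<c (small 0 z≤n)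
  window (suc p) cq≤d d<cq+c with suc p ℕ.≤? 2
  ... | yes q≤2 = contradiction d<cq+c (small (suc p) q≤2)
  ... | no q≰2  = p , cq≤d , (begin
    d                                ≤⟨ ℕ.<⇒≤ d<cq+c ⟩
    c + c * suc p                    ≡⟨ eq ℓ (suc p) ⟩
    4 * ℓ * 3 + 12 * ℓ * suc p       ≤⟨ ℕ.+-monoˡ-≤ (c * suc p) (ℕ.*-monoʳ-≤ (4 * ℓ) (ℕ.≰⇒> q≰2)) ⟩
    4 * ℓ * suc p + 12 * ℓ * suc p   ≡⟨ eq′ ℓ (suc p) ⟩
    16 * ℓ * suc p                   ∎)
    where
    eq : ∀ ℓ q → 12 * ℓ + 12 * ℓ * q ≡ 4 * ℓ * 3 + 12 * ℓ * q
    eq = solve-∀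
    eq′ : ∀ ℓ q → 4 * ℓ * q + 12 * ℓ * q ≡ 16 * ℓ * q
    eq′ = solve-∀

lower-end : ∀ ℓ .⦃ _ : NonZero ℓ ⦄ r x → 13 * ℓ * r ≤ x + r → 12 * ℓ * r ≤ x
lower-end ℓ r x le = ℕ.+-cancelʳ-≤ r (12 * ℓ * r) x (begin
  12 * ℓ * r + r          ≤⟨ ℕ.+-monoʳ-≤ (12 * ℓ * r) (ℕ.m≤n*m r ℓ) ⟩
  12 * ℓ * r + ℓ * r      ≡⟨ eq ℓ r ⟩
  13 * ℓ * r              ≤⟨ le ⟩
  x + r                   ∎)
  where
  open ℕ.≤-Reasoning
  eq : ∀ ℓ r → 12 * ℓ * r + ℓ * r ≡ 13 * ℓ * r
  eq = solve-∀

upper-end : ∀ ℓ .⦃ _ : NonZero ℓ ⦄ r x → x ≤ 13 * ℓ * r + r → x ≤ 16 * ℓ * r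
upper-end ℓ r x le = begin
  x                                ≤⟨ le ⟩
  13 * ℓ * r + r                   ≤⟨ ℕ.+-monoʳ-≤ (13 * ℓ * r) (ℕ.m≤n*m r (3 * ℓ) ⦃ ℕ.m*n≢0 3 ℓ ⦄) ⟩
  13 * ℓ * r + 3 * ℓ * r           ≡⟨ eq ℓ r ⟩
  16 * ℓ * r                       ∎
  where
  open ℕ.≤-Reasoning
  eq : ∀ ℓ r → 13 * ℓ * r + 3 * ℓ * r ≡ 16 * ℓ * r
  eq = solve-∀

module _ (ℓ : ℕ) .⦃ _ : NonZero ℓ ⦄ {r} (r≤2^ℓ+1 : r ≤ 2 ^ suc ℓ) {n} (H : Hypergraph n)
         {d} (reg : ∀ v → deg H v ≡ d) (uni : Uniform r H) where

  medium-cover : 50 * ℓ < d → d ≤ 13 * ℓ * r → ∃[ C ] (C ⊆ H × (∀ v → 1 ≤ deg C v × deg C v ≤ 50 * ℓ))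
  medium-cover 50ℓ<d d≤13ℓr with quotient-window ℓ d 50ℓ<d
  ... | p , lower , upper = sample H ℓ p uni
    (λ v → subst (λ x → 12 * ℓ * suc p ≤ x × x ≤ 16 * ℓ * suc p) (sym (reg v)) (lower , upper)) q≤2r r≤2^ℓ+1
    where
    open ℕ.≤-Reasoning
    instance _ = ℕ.m*n≢0 12 ℓ
    eq : ∀ ℓ r → 13 * ℓ * r + 11 * ℓ * r ≡ 12 * ℓ * (2 * r)
    eq = solve-∀
    q≤2r : suc p ≤ 2 * r
    q≤2r = ℕ.*-cancelˡ-≤ (12 * ℓ) (begin
      12 * ℓ * suc p                   ≤⟨ lower ⟩
      d                                ≤⟨ d≤13ℓr ⟩
      13 * ℓ * r                       ≤⟨ ℕ.m≤m+n (13 * ℓ * r) (11 * ℓ * r) ⟩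
      13 * ℓ * r + 11 * ℓ * r          ≡⟨ eq ℓ r ⟩
      12 * ℓ * (2 * r)                 ∎)

  -- Here `q = r`: the rounding error `r` is at most `ℓ r`, so `13 ℓ r ± r` stays inside the window.
  dense-cover : 0 < d → 0 < r → 13 * ℓ * r ≤ d → ∃[ C ] (C ⊆ H × (∀ v → 1 ≤ deg C v × deg C v ≤ 50 * ℓ))
  dense-cover 0<d 0<r 13ℓr≤d =
    let H′ , H′⊆H , uni′ , near-13ℓr = thin H (13 * ℓ * r) uni reg 0<d 13ℓr≤d
        C , C⊆H′ , bounds = sample H′ ℓ (pred r) uni′
          (λ v → subst (λ q → 12 * ℓ * q ≤ deg H′ v × deg H′ v ≤ 16 * ℓ * q) (sym q≡r)
            (lower-end ℓ r (deg H′ v) (proj₂ (near-13ℓr v)) , upper-end ℓ r (deg H′ v) (proj₁ (near-13ℓr v))))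
          (subst (_≤ 2 * r) (sym q≡r) (ℕ.m≤n*m r 2)) r≤2^ℓ+1
    in C , H′⊆H ∘ C⊆H′ , bounds
    where
    q≡r : suc (pred r) ≡ r
    q≡r = ℕ.suc-pred r ⦃ >-nonZero 0<r ⦄

bounded-cover : ∀ {r} ℓ .⦃ _ : NonZero ℓ ⦄ → 2 ≤ r → r ≤ 2 ^ suc ℓ → Admissible r (50 * ℓ)
bounded-cover {r} ℓ 2≤r r≤2^ℓ+1 H nonempty (d , reg) uni with d ℕ.≤? 50 * ℓ | 13 * ℓ * r ℕ.≤? d
... | yes d≤50ℓ | _          = H , id , λ v → subst (λ x → 1 ≤ x × x ≤ 50 * ℓ) (sym (reg v)) (0<d , d≤50ℓ)
  where
  0<d : 0 < d
  0<d = degree-positive H nonempty uni (ℕ.<⇒≤ 2≤r) reg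
... | no _      | yes 13ℓr≤d = dense-cover ℓ r≤2^ℓ+1 H reg uni
  (degree-positive H nonempty uni (ℕ.<⇒≤ 2≤r) reg) (ℕ.<⇒≤ 2≤r) 13ℓr≤d
... | no d≰50ℓ  | no 13ℓr≰d  = medium-cover ℓ r≤2^ℓ+1 H reg uni (ℕ.≰⇒> d≰50ℓ) (ℕ.<⇒≤ (ℕ.≰⇒> 13ℓr≰d))

-- The logarithm

∑-extend : ∀ f → (∀ k → 0ℚ ℚ.≤ f k) → ∀ {a b} → a ≤ b → ∑ a f ℚ.≤ ∑ b f
∑-extend f f≥0 {a} {b} a≤b = begin
  ∑ a f                                            ≡⟨ sym (ℚ.+-identityʳ (∑ a f)) ⟩
  ∑ a f ℚ.+ 0ℚ                                     ≤⟨ ℚ.+-monoʳ-≤ (∑ a f) (∑-nonNeg (b ∸ a)) ⟩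
  ∑ a f ℚ.+ ∑ (b ∸ a) (λ j → f (a + j))            ≡⟨ sym (∑-split a (b ∸ a) f) ⟩
  ∑ (b ∸ a + a) f                                  ≡⟨ cong (λ n → ∑ n f) (ℕ.m∸n+n≡m a≤b) ⟩
  ∑ b f                                            ∎
  where
  open ℚ.≤-Reasoning
  ∑-nonNeg : ∀ n → 0ℚ ℚ.≤ ∑ n (λ j → f (a + j))
  ∑-nonNeg zero    = ℚ.≤-refl
  ∑-nonNeg (suc n) = ℚ.+-mono-≤ (∑-nonNeg n) (f≥0 (a + n))

recip-nonNeg : ∀ k → 0ℚ ℚ.≤ recip k
recip-nonNeg k = ℚ.<⇒≤ (ℚ.positive⁻¹ (recip k) ⦃ recip-pos k ⦄)

-- The terms of the left Riemann sum on the interval [2 ^ ℓ, 2 ^ (ℓ + 1)].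
dyadic-block : ∀ ℓ N → ½ ℚ.≤ ∑ (2 ^ ℓ * suc N) (λ j → recip (N + ((2 ^ ℓ ∸ 1) * suc N + j)))
dyadic-block ℓ N = begin
  -- The `n` terms of the block are `1 / (n + j)` with `j < n`, each at least `1 / (2 n)`.
  ½                                        ≡⟨ sym (fromℕ*recip n (pred (n * 2)) 1 (ℕ.suc-pred (n * 2) ⦃ ℕ.m*n≢0 n 2 ⦄)) ⟩
  fromℕ n ℚ.* recip (pred (n * 2))         ≡⟨ sym (∑-const n (recip (pred (n * 2)))) ⟩
  ∑ n (λ _ → recip (pred (n * 2)))         ≤⟨ ∑-mono n (λ j j<n → recip-anti (index j j<n)) ⟩
  ∑ n (λ j → recip (N + (m + j)))          ∎
  where
  open ℚ.≤-Reasoning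
  n = 2 ^ ℓ * suc N
  m = (2 ^ ℓ ∸ 1) * suc N
  instance
    2^ℓ≢0 : NonZero (2 ^ ℓ)
    2^ℓ≢0 = ℕ.m^n≢0 2 ℓ
    n≢0 : NonZero n
    n≢0 = ℕ.m*n≢0 (2 ^ ℓ) (suc N)
  1+N+m≡n : suc N + m ≡ n
  1+N+m≡n = cong (_* suc N) (ℕ.suc-pred (2 ^ ℓ))
  double : n * 2 ≡ n + n
  double = trans (ℕ.*-comm n 2) (cong (λ x → n + x) (ℕ.+-identityʳ n))
  index : ∀ j → j < n → N + (m + j) ≤ pred (n * 2)
  index j j<n = ℕ.<⇒≤pred (subst₂ _<_ (ℕ.+-assoc N m j) (sym double)
    (ℕ.≤-trans (ℕ.≤-reflexive (cong (_+ j) 1+N+m≡n)) (ℕ.+-monoʳ-≤ n (ℕ.<⇒≤ j<n))))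

-- The block estimate is uniform in the step size, so the bound holds for every Riemann sum and not
-- just in the limit.
½ℓ≤riemann : ∀ {r} ℓ → 2 ^ ℓ ≤ r → ∀ N → ∑ ℓ (λ _ → ½) ℚ.≤ riemann r N
½ℓ≤riemann {r} ℓ 2^ℓ≤r N = ℚ.≤-trans (dyadic ℓ)
  (∑-extend f (λ k → recip-nonNeg (N + k)) (ℕ.*-monoˡ-≤ (suc N) (ℕ.∸-monoˡ-≤ 1 2^ℓ≤r)))
  where
  open ℚ.≤-Reasoning
  f : ℕ → ℚ
  f k = recip (N + k)
  next : ∀ ℓ → 2 ^ ℓ * suc N + (2 ^ ℓ ∸ 1) * suc N ≡ (2 ^ suc ℓ ∸ 1) * suc N
  next ℓ = trans (sym (ℕ.*-distribʳ-+ (suc N) (2 ^ ℓ) (2 ^ ℓ ∸ 1))) (cong (_* suc N)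
    (trans (sym (ℕ.+-∸-assoc (2 ^ ℓ) (ℕ.m^n>0 2 ℓ))) (cong (λ a → 2 ^ ℓ + a ∸ 1) (sym (ℕ.+-identityʳ (2 ^ ℓ))))))
  dyadic : ∀ ℓ → ∑ ℓ (λ _ → ½) ℚ.≤ ∑ ((2 ^ ℓ ∸ 1) * suc N) f
  dyadic zero    = ℚ.≤-refl
  dyadic (suc ℓ) = begin
    ∑ ℓ (λ _ → ½) ℚ.+ ½                                     ≤⟨ ℚ.+-mono-≤ (dyadic ℓ) (dyadic-block ℓ N) ⟩
    ∑ ((2 ^ ℓ ∸ 1) * suc N) f ℚ.+ ∑ (2 ^ ℓ * suc N) (λ j → f ((2 ^ ℓ ∸ 1) * suc N + j))
      ≡⟨ sym (∑-split ((2 ^ ℓ ∸ 1) * suc N) (2 ^ ℓ * suc N) f) ⟩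
    ∑ (2 ^ ℓ * suc N + (2 ^ ℓ ∸ 1) * suc N) f               ≡⟨ cong (λ n → ∑ n f) (next ℓ) ⟩
    ∑ ((2 ^ suc ℓ ∸ 1) * suc N) f                           ∎

∑-1 : ∀ n → ∑ n (λ _ → 1ℚ) ≡ fromℕ n
∑-1 n = trans (∑-const n 1ℚ) (ℚ.*-identityʳ (fromℕ n))

fromℕ-mono : ∀ {a b} → a ≤ b → fromℕ a ℚ.≤ fromℕ b
fromℕ-mono {a} {b} a≤b = subst₂ ℚ._≤_ (∑-1 a) (∑-1 b) (∑-extend (λ _ → 1ℚ) (λ _ → recip-nonNeg 0) a≤b)

fromℕ[ℓ*50]≡100*½ℓ : ∀ ℓ → fromℕ (ℓ * 50) ≡ fromℕ 100 ℚ.* ∑ ℓ (λ _ → ½)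
fromℕ[ℓ*50]≡100*½ℓ ℓ = begin
  fromℕ (ℓ * 50)                                 ≡⟨ sym (∑-1 (ℓ * 50)) ⟩
  ∑ (ℓ * 50) (λ _ → 1ℚ)                          ≡⟨ ∑-blocks ℓ 50 (λ _ → 1ℚ) ⟩
  ∑ ℓ (λ _ → ∑ 50 (λ _ → 1ℚ))                    ≡⟨ ∑-const ℓ (∑ 50 (λ _ → 1ℚ)) ⟩
  fromℕ ℓ ℚ.* ∑ 50 (λ _ → 1ℚ)                    ≡⟨ cong (fromℕ ℓ ℚ.*_) fifty ⟩
  fromℕ ℓ ℚ.* (fromℕ 100 ℚ.* ½)                  ≡⟨ swap (fromℕ ℓ) (fromℕ 100) ½ ⟩
  fromℕ 100 ℚ.* (fromℕ ℓ ℚ.* ½)                  ≡⟨ cong (fromℕ 100 ℚ.*_) (sym (∑-const ℓ ½)) ⟩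
  fromℕ 100 ℚ.* ∑ ℓ (λ _ → ½)                    ∎
  where
  open ≡-Reasoning
  fifty : ∑ 50 (λ _ → 1ℚ) ≡ fromℕ 100 ℚ.* ½
  fifty = refl
  swap : ∀ a b c → a ℚ.* (b ℚ.* c) ≡ b ℚ.* (a ℚ.* c)
  swap = solve 3 (λ a b c → a :* (b :* c) := b :* (a :* c)) refl
    where open +-*-Solver

≤100log : ∀ {r} ℓ → 2 ^ ℓ ≤ r → ∀ {x} → x ≤ 50 * ℓ → fromℕᴿ x ≤ᴿ 100 · log r
≤100log {r} ℓ 2^ℓ≤r {x} x≤50ℓ ε 0<ε = 0 , λ N _ → begin
  fromℕ x                                ≤⟨ fromℕ-mono (subst (x ≤_) (ℕ.*-comm 50 ℓ) x≤50ℓ) ⟩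
  fromℕ (ℓ * 50)                         ≡⟨ fromℕ[ℓ*50]≡100*½ℓ ℓ ⟩
  fromℕ 100 ℚ.* ∑ ℓ (λ _ → ½)            ≤⟨ ℚ.*-monoˡ-≤-nonNeg (fromℕ 100) ⦃ fromℕ-nonNeg 100 ⦄ (½ℓ≤riemann ℓ 2^ℓ≤r N) ⟩
  fromℕ 100 ℚ.* riemann r N              ≡⟨ sym (ℚ.+-identityʳ (fromℕ 100 ℚ.* riemann r N)) ⟩
  fromℕ 100 ℚ.* riemann r N ℚ.+ 0ℚ       ≤⟨ ℚ.+-monoʳ-≤ (fromℕ 100 ℚ.* riemann r N) (ℚ.<⇒≤ 0<ε) ⟩
  fromℕ 100 ℚ.* riemann r N ℚ.+ ε        ∎
  where open ℚ.≤-Reasoning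

floor-log₂ : ∀ n → ∃[ ℓ ] (2 ^ ℓ ≤ suc n × suc n < 2 ^ suc ℓ)
floor-log₂ zero    = 0 , s≤s z≤n , s≤s (s≤s z≤n)
floor-log₂ (suc n) with floor-log₂ n
... | ℓ , lower , upper with suc (suc n) ℕ.<? 2 ^ suc ℓ
... | yes smaller = ℓ , ℕ.m≤n⇒m≤1+n lower , smaller
... | no ≮ = suc ℓ , ℕ.≮⇒≥ ≮ , ℕ.≤-<-trans upper (ℕ.^-monoʳ-< 2 (s≤s (s≤s z≤n)) (ℕ.n<1+n (suc ℓ)))

-- Without a least witness, `P t` fails whenever `P` fails below `t`, and strong induction refutes
-- `P` everywhere.
¬¬-least : ∀ (P : ℕ → Set) {t} → P t → ¬ ¬ (∃[ s ] P s × (∀ s′ → P s′ → s ≤ s′))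
¬¬-least P Pt ¬least = none _ Pt
  where
  none : ∀ t → ¬ P t
  none = <-rec (λ t → ¬ P t) λ t smaller Pt → ¬least (t , Pt , λ s Ps → ℕ.≮⇒≥ λ s<t → smaller s<t Ps)

theorem1p2 : ∀ (r : ℕ) → 2 ≤ r →
    (∀ {n} (H : Hypergraph n) → Nonempty H → Regular H → Uniform r H →
    ∃[ C ] (C ⊆ H × (∀ v → 1 ≤ deg C v × fromℕᴿ (deg C v) ≤ᴿ 100 · log r)))
    × (¬ ¬ (∃[ t ] IsF r t))
    × (∀ t → IsF r t → fromℕᴿ t ≤ᴿ 100 · log r)
theorem1p2 r@(suc r-1) 2≤r with floor-log₂ r-1
... | zero , _ , r<2 = contradiction 2≤r (ℕ.<⇒≱ r<2)
... | ℓ@(suc _) , 2^ℓ≤r , r<2^ℓ+1 =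
    (λ H nonempty reg uni → map₂ (map₂ λ bounds v → map₂ (≤100log ℓ 2^ℓ≤r) (bounds v)) (admissible H nonempty reg uni))
  , ¬¬-least (Admissible r) (λ {n} → admissible {n})
  , (λ t isF → ≤100log ℓ 2^ℓ≤r (proj₂ isF (50 * ℓ) admissible))
  where
  admissible : Admissible r (50 * ℓ)
  admissible = bounded-cover ℓ 2≤r (ℕ.<⇒≤ r<2^ℓ+1)
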